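{- Let $k=2^{\ell}$ for an integer $\ell\ge 2$ and let $q=4k$. Let $a,b\in\mathfrak S_q$ be the permutations $$a=(c_0,c_1)(c_2,c_3)\cdots(c_{4k-2},c_{4k-1}),$$ and $b=C_1C_2$, where $C_1$ and $C_2$ are the following two disjoint $2k$-cycles: - $C_1$ is the cycle whose entries, in order, are: for $m=0,1,\dots,\frac{k-2}{2}$ successively the pair $c_{2m},\,c_{2(2m+k-1)}$; then for $n=0,1,\dots,\frac{k-4}{2}$ successively the pair $c_{2n+k},\,c_{2(2n+k)}$; and finally $c_{4k-1},\,c_{4k-4}$. That is, $C_1=(c_0,c_{2k-2},c_2,c_{2k+2},\dots,c_{k-2},c_{4k-6},c_k,c_{2k},c_{k+2},c_{2k+4},\dots,c_{2k-4},c_{4k-8},c_{4k-1},c_{4k-4})$. - $C_2$ is the cycle whose entries, in order, are: for $m=0,1,\dots,\frac{k-2}{2}$ successively the pair $c_{2m+1},\,c_{2(2m+k)+1}$; then for $n=0,1,\dots,\frac{k-4}{2}$ successively the pair $c_{2n+k+1},\,c_{2(2n+k)-1}$; and finally $c_{4k-2},\,c_{4k-5}$. That is, $C_2=(c_1,c_{2k+1},c_3,c_{2k+5},\dots,c_{k-1},c_{4k-3},c_{k+1},c_{2k-1},c_{k+3},c_{2k+3},\dots,c_{2k-3},c_{4k-9},c_{4k-2},c_{4k-5})$. Then $G_1=\{b^{j}a^{i}: 0\le j\le 2k-1,\ 0\le i\le 1\}$ is a subgroup of $\mathfrak S_q$ with $|G_1|=q$, and no element of $G_1$ other than the identity has a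 fixed point.
   Context: $q$ is a prime power and the elements of the finite field $\mathbb F_q$ are enumerated once and for all as $\mathbb F_q=\{c_0,c_1,\dots,c_{q-1}\}$. $\mathfrak S_q$ denotes the symmetric group of all permutations of $\mathbb F_q$; products of permutations are compositions applied right to left, $(\sigma\tau)(x)=\sigma(\tau(x))$, and permutations are written in cycle notation. -}

module Defs where

open import Level using (0ℓ; _⊔_)
open import Algebra.Bundles using (Group)
open import Algebra.Core using (Op₁; Op₂)
open import Algebra.Definitions using (Invertible)
open import Algebra.Structures using (IsCommutativeRing)
open import Data.Fin using (Fin; fromℕ<)
import Data.Fin.Properties as Fin
open import Data.List using (List; []; _∷_; length; _++_; _∷ʳ_; map; concatMap; upTo)
open import Data.List.Membership.DecPropositional using (_∈?_)
open import Data.List.Membership.Propositional using () renaming (_∈_ to _∈ₗ_)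
open import Data.List.Membership.Propositional.Properties using (∈-++⁻)
open import Data.List.Relation.Binary.Permutation.Propositional using (_↭_; ↭-sym)
open import Data.List.Relation.Binary.Permutation.Propositional.Properties using (∈-resp-↭; ∷↭∷ʳ; ↭-length)
open import Data.List.Relation.Unary.All as All using (All; []; _∷_)
import Data.List.Relation.Unary.All.Properties as All
open import Data.List.Relation.Unary.AllPairs using ([]; _∷_)
import Data.List.Relation.Unary.AllPairs.Properties as AllPairs
open import Data.List.Relation.Unary.Any using (here; there)
open import Data.List.Relation.Unary.Unique.Propositional using (Unique)
import Data.List.Relation.Unary.Unique.Propositional.Properties as Unique
open import Data.Nat using (ℕ; suc; NonZero; _+_; _*_; _∸_; _^_; _/_; _≤_; _<_; z≤n; s≤s)
open import Data.Nat.DivMod using (m/n*n≤m)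
open import Data.Nat.Properties hiding (_≟_)
open import Data.Nat.Tactic.RingSolver using (solve-∀)
open import Data.Product using (∃; ∃₂; _×_; _,_; proj₁; proj₂)
open import Data.Sum using (_⊎_; inj₁; inj₂)
open import Function using (_↔_; Inverse; mk↔ₛ′; _∘_; id)
open import Function.Construct.Composition using (_↔-∘_)
open import Function.Construct.Identity using (↔-id)
open import Function.Construct.Symmetry using (↔-sym)
open import Function.Properties.Inverse using (↔⇒↣)
open import Relation.Binary using (DecidableEquality)
import Relation.Binary.Construct.On as On
open import Relation.Binary.PropositionalEquality hiding (setoid)
open import Relation.Binary.PropositionalEquality.Properties using () renaming (setoid to ≡-setoid)
open import Relation.Nullary using (¬_; yes; no; contradiction)
open import Relation.Nullary.Decidable using (via-injection)
open import Relation.Unary using (Pred)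

private variable
  A : Set

record Field : Set₁ where
  field
    Carrier           : Set
    _+ᶠ_ _*ᶠ_         : Op₂ Carrier
    -ᶠ_               : Op₁ Carrier
    0# 1#             : Carrier
    isCommutativeRing : IsCommutativeRing _≡_ _+ᶠ_ _*ᶠ_ -ᶠ_ 0# 1#
    0#≢1#             : 0# ≢ 1#
    invertible        : ∀ x → x ≢ 0# → Invertible _≡_ 1# _*ᶠ_ x

-- Two permutations are equal when they agree pointwise; σ ∙ τ applies τ first.
Sym : Set → Group 0ℓ 0ℓ
Sym A = record
  { Carrier = A ↔ A
  ; _≈_     = λ σ τ → to σ ≗ to τ
  ; _∙_     = _↔-∘_
  ; ε       = ↔-id A
  ; _⁻¹     = ↔-sym
  ; isGroup = record
    { isMonoid = record
      { isSemigroup = record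
        { isMagma = record
          { isEquivalence = record
            { refl  = λ _ → refl
            ; sym   = λ eq x → sym (eq x)
            ; trans = λ eq₁ eq₂ x → trans (eq₁ x) (eq₂ x)
            }
          ; ∙-cong = λ {σ} eq₁ eq₂ x → trans (cong (to σ) (eq₂ x)) (eq₁ _)
          }
        ; assoc = λ _ _ _ _ → refl
        }
      ; identity = (λ _ _ → refl) , (λ _ _ → refl)
      }
    ; inverse = (λ σ → strictlyInverseʳ σ) , (λ σ → strictlyInverseˡ σ)
    ; ⁻¹-cong = λ {σ} {τ} eq x →
        trans (cong (from σ) (trans (sym (strictlyInverseˡ τ x)) (sym (eq (from τ x)))))
              (strictlyInverseʳ σ (from τ x))
    }
  }
  where open Inverse

HasFixedPoint : A ↔ A → Set
HasFixedPoint σ = ∃ λ x → Inverse.to σ x ≡ x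

module _ {c ℓ} (G : Group c ℓ) where
  open Group G
  open import Algebra.Definitions.RawMonoid rawMonoid using () renaming (_×_ to _·_)

  power : Carrier → ℕ → Carrier
  power g n = n · g

  record IsSubgroup {p} (H : Pred Carrier p) : Set (c ⊔ ℓ ⊔ p) where
    field
      respects  : ∀ {x y} → x ≈ y → H x → H y
      ε-closed  : H ε
      ∙-closed  : ∀ {x y} → H x → H y → H (x ∙ y)
      ⁻¹-closed : ∀ {x} → H x → H (x ⁻¹)

  -- Elements of H are counted up to the equality of G.
  HasOrder : ∀ {p} → Pred Carrier p → ℕ → Set (c ⊔ ℓ ⊔ p)
  HasOrder H n = Inverse (On.setoid setoid (proj₁ {B = H})) (≡-setoid (Fin n))

module _ (_≟_ : DecidableEquality A) where

  relabel : List A → List A → A → A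
  relabel (u ∷ us) (v ∷ vs) x with x ≟ u
  ... | yes _ = v
  ... | no  _ = relabel us vs x
  relabel _ _ x = x

  rotate : List A → List A
  rotate []       = []
  rotate (x ∷ xs) = xs ∷ʳ x

  private
    relabel-∉ : ∀ us vs {x} → ¬ x ∈ₗ us → relabel us vs x ≡ x
    relabel-∉ []       _        _   = refl
    relabel-∉ (_ ∷ _)  []       _   = refl
    relabel-∉ (u ∷ us) (v ∷ vs) {x} x∉ with x ≟ u
    ... | yes refl = contradiction (here refl) x∉
    ... | no  _    = relabel-∉ us vs (x∉ ∘ there)

    relabel-∈ : ∀ us vs {x} → length us ≡ length vs → x ∈ₗ us → relabel us vs x ∈ₗ vs
    relabel-∈ (u ∷ us) (v ∷ vs) {x} eq x∈ with x ≟ u | x∈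
    ... | yes _ | _         = here refl
    ... | no x≢ | here x≡u  = contradiction x≡u x≢
    ... | no _  | there x∈′ = there (relabel-∈ us vs (suc-injective eq) x∈′)

    relabel-relabel : ∀ us vs {x} → length us ≡ length vs → Unique vs →
                      x ∈ₗ us → relabel vs us (relabel us vs x) ≡ x
    relabel-relabel (u ∷ us) (v ∷ vs) {x} eq (v∉ ∷ uniq) x∈ with x ≟ u | x∈
    ... | no x≢ | here x≡u = contradiction x≡u x≢
    ... | yes refl | _ with v ≟ v
    ...   | yes _ = refl
    ...   | no v≢ = contradiction refl v≢
    relabel-relabel (u ∷ us) (v ∷ vs) {x} eq (v∉ ∷ uniq) x∈
        | no _ | there x∈′ with relabel us vs x ≟ v
    ...   | yes y≡v = contradiction (sym y≡v) (All.lookup v∉ (relabel-∈ us vs (suc-injective eq) x∈′))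
    ...   | no  _   = relabel-relabel us vs (suc-injective eq) uniq x∈′

    relabel-inverse : ∀ us vs → us ↭ vs → Unique vs → ∀ x → relabel vs us (relabel us vs x) ≡ x
    relabel-inverse us vs us↭vs uniq x with _∈?_ _≟_ x us
    ... | yes x∈ = relabel-relabel us vs (↭-length us↭vs) uniq x∈
    ... | no  x∉ = trans (cong (relabel vs us) (relabel-∉ us vs x∉))
                         (relabel-∉ vs us (x∉ ∘ ∈-resp-↭ (↭-sym us↭vs)))

    rotate-↭ : ∀ xs → xs ↭ rotate xs
    rotate-↭ []       = _↭_.refl
    rotate-↭ (x ∷ xs) = ∷↭∷ʳ x xs

    rotate-unique : ∀ {xs} → Unique xs → Unique (rotate xs)
    rotate-unique []         = []
    rotate-unique (x∉ ∷ xs!) = Unique.++⁺ xs! ([] ∷ []) λ where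
      (y∈ , here refl) → contradiction refl (All.lookup x∉ y∈)

  -- (x₁, …, xₙ): each entry goes to the next one, the last to the first.
  cycle : (xs : List A) → Unique xs → A ↔ A
  cycle xs xs! = mk↔ₛ′ (relabel xs (rotate xs)) (relabel (rotate xs) xs)
    (relabel-inverse (rotate xs) xs (↭-sym (rotate-↭ xs)) xs!)
    (relabel-inverse xs (rotate xs) (rotate-↭ xs) (rotate-unique xs!))

-- Entries of a cycle written by index: distinct, and in the range of an
-- enumeration of q elements.
Valid : ℕ → List ℕ → Set
Valid q is = All (_< q) is × Unique is

module _ {q : ℕ} (c : Fin q ↔ A) where
  open Inverse c

  entries : (is : List ℕ) → .(All (_< q) is) → List A
  entries []       _  = []
  entries (i ∷ is) <q = to (fromℕ< (All.head <q)) ∷ entries is (All.tail <q)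

  enumerated-≟ : DecidableEquality A
  enumerated-≟ = via-injection (↔⇒↣ (↔-sym c)) Fin._≟_

  private
    to-injective : ∀ {i j} → to i ≡ to j → i ≡ j
    to-injective eq = trans (sym (strictlyInverseʳ _)) (trans (cong from eq) (strictlyInverseʳ _))

    entries-≢ : ∀ {i} .(i<q : i < q) is .(<q : All (_< q) is) → All (i ≢_) is →
                All (to (fromℕ< i<q) ≢_) (entries is <q)
    entries-≢ i<q []       <q []         = []
    entries-≢ i<q (j ∷ is) <q (i≢j ∷ i∉) =
      (λ eq → i≢j (Fin.fromℕ<-injective _ _ i<q (All.head <q) (to-injective eq)))
      ∷ entries-≢ i<q is (All.tail <q) i∉

  entries-unique : ∀ is .(<q : All (_< q) is) → Unique is → Unique (entries is <q)
  entries-unique []       <q []         = []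
  entries-unique (i ∷ is) <q (i∉ ∷ is!) =
    entries-≢ (All.head <q) is (All.tail <q) i∉ ∷ entries-unique is (All.tail <q) is!

  indexCycle : (is : List ℕ) → Valid q is → A ↔ A
  indexCycle is (<q , is!) = cycle enumerated-≟ (entries is <q) (entries-unique is <q is!)

  -- The first cycle of the list is the leftmost factor.
  indexCycles : (iss : List (List ℕ)) → All (Valid q) iss → A ↔ A
  indexCycles []         _  = Group.ε (Sym A)
  indexCycles (is ∷ iss) vs =
    Group._∙_ (Sym A) (indexCycle is (All.head vs)) (indexCycles iss (All.tail vs))

a-indices : ℕ → List (List ℕ)
a-indices k = map (λ i → 2 * i ∷ 2 * i + 1 ∷ []) (upTo (2 * k))

-- Every subtraction below is exact once k ≥ 4.
C₁-indices C₂-indices : ℕ → List ℕ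
C₁-indices k =
     concatMap (λ m → 2 * m ∷ 2 * (2 * m + k ∸ 1) ∷ []) (upTo (suc ((k ∸ 2) / 2)))
  ++ concatMap (λ n → 2 * n + k ∷ 2 * (2 * n + k) ∷ []) (upTo (suc ((k ∸ 4) / 2)))
  ++ 4 * k ∸ 1 ∷ 4 * k ∸ 4 ∷ []
C₂-indices k =
     concatMap (λ m → 2 * m + 1 ∷ 2 * (2 * m + k) + 1 ∷ []) (upTo (suc ((k ∸ 2) / 2)))
  ++ concatMap (λ n → 2 * n + k + 1 ∷ 2 * (2 * n + k) ∸ 1 ∷ []) (upTo (suc ((k ∸ 4) / 2)))
  ++ 4 * k ∸ 2 ∷ 4 * k ∸ 5 ∷ []

private
  module _ (f g : ℕ → ℕ) (n : ℕ) where
    pairs : List ℕ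
    pairs = concatMap (λ m → f m ∷ g m ∷ []) (upTo n)

    pairs-all : {P : Pred ℕ 0ℓ} → (∀ {m} → m < n → P (f m)) → (∀ {m} → m < n → P (g m)) → All P pairs
    pairs-all pf pg = All.concat⁺ (All.map⁺ (All.applyUpTo⁺₁ id n λ m<n → pf m<n ∷ pg m<n ∷ []))

    pairs-∉ : ∀ {x} → (∀ {m} → m < n → f m ≢ x) → (∀ {m} → m < n → g m ≢ x) → ¬ x ∈ₗ pairs
    pairs-∉ {x} f≢x g≢x x∈ = All.lookup (pairs-all {P = _≢ x} f≢x g≢x) x∈ refl

    pairs-unique : (∀ {i j} → f i ≡ f j → i ≡ j) → (∀ {i j} → g i ≡ g j → i ≡ j) →
                   (∀ {i j} → i < n → j < n → f i ≢ g j) → Unique pairs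
    pairs-unique f-inj g-inj f≢g = Unique.concat⁺
      (All.map⁺ (All.applyUpTo⁺₁ id n λ m<n → (f≢g m<n m<n ∷ []) ∷ [] ∷ []))
      (AllPairs.map⁺ (AllPairs.applyUpTo⁺₁ id n λ i<j j<n → λ where
        (here refl , here eq)                 → <⇒≢ i<j (f-inj eq)
        (here refl , there (here eq))         → f≢g (<-trans i<j j<n) j<n eq
        (there (here refl) , here eq)         → f≢g j<n (<-trans i<j j<n) (sym eq)
        (there (here refl) , there (here eq)) → <⇒≢ i<j (g-inj eq)))

  below : ∀ {x y z} → x < y → y ≤ z → x ≢ z
  below x<y y≤z refl = <-irrefl refl (<-≤-trans x<y y≤z)

  -- f < A ≤ f′ < B ≤ everything else
  unique-by-blocks :
    ∀ A B (f g f′ g′ : ℕ → ℕ) N N′ u v →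
    (∀ {i j} → f i ≡ f j → i ≡ j) → (∀ {i j} → g i ≡ g j → i ≡ j) →
    (∀ {i j} → f′ i ≡ f′ j → i ≡ j) → (∀ {i j} → g′ i ≡ g′ j → i ≡ j) →
    (∀ {m} → m < N → f m < A) → A ≤ B → (∀ n → A ≤ f′ n) → (∀ {n} → n < N′ → f′ n < B) →
    (∀ m → B ≤ g m) → (∀ n → B ≤ g′ n) → B ≤ u → B ≤ v →
    (∀ m n → g m ≢ g′ n) → (∀ {m} → m < N → g m ≢ u) → (∀ {m} → m < N → g m ≢ v) →
    (∀ {n} → n < N′ → g′ n ≢ u) → (∀ {n} → n < N′ → g′ n ≢ v) → u ≢ v →
    Unique (pairs f g N ++ pairs f′ g′ N′ ++ u ∷ v ∷ [])
  unique-by-blocks A B f g f′ g′ N N′ u v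
    f-inj g-inj f′-inj g′-inj f<A A≤B A≤f′ f′<B B≤g B≤g′ B≤u B≤v g≢g′ g≢u g≢v g′≢u g′≢v u≢v =
    Unique.++⁺ (pairs-unique f g N f-inj g-inj λ i<N _ → below (f<B i<N) (B≤g _))
      (Unique.++⁺ (pairs-unique f′ g′ N′ f′-inj g′-inj λ i<N′ _ → below (f′<B i<N′) (B≤g′ _))
                  ((u≢v ∷ []) ∷ [] ∷ [])
                  λ (x∈ , x∈′) → All.lookup second x∈ x∈′)
      λ (x∈ , x∈′) → All.lookup first x∈ (∈-++⁻ (pairs f′ g′ N′) x∈′)
    where
    f<B : ∀ {m} → m < N → f m < B
    f<B m<N = <-≤-trans (f<A m<N) A≤B
    second : All (λ x → ¬ x ∈ₗ u ∷ v ∷ []) (pairs f′ g′ N′)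
    second = pairs-all f′ g′ N′
      (λ { n< (here eq) → below (f′<B n<) B≤u eq ; n< (there (here eq)) → below (f′<B n<) B≤v eq })
      (λ { n< (here eq) → g′≢u n< eq             ; n< (there (here eq)) → g′≢v n< eq })
    first : All (λ x → ¬ (x ∈ₗ pairs f′ g′ N′ ⊎ x ∈ₗ u ∷ v ∷ [])) (pairs f g N)
    first = pairs-all f g N
      (λ { m< (inj₁ x∈) → pairs-∉ f′ g′ N′ (λ _ eq → below (<-≤-trans (f<A m<) (A≤f′ _)) ≤-refl (sym eq))
                                           (λ _ eq → below (f<B m<) (B≤g′ _) (sym eq)) x∈
         ; m< (inj₂ (here eq))         → below (f<B m<) B≤u eq
         ; m< (inj₂ (there (here eq))) → below (f<B m<) B≤v eq })
      (λ { m< (inj₁ x∈) → pairs-∉ f′ g′ N′ (λ n< → below (f′<B n<) (B≤g _))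
                                           (λ _ eq → g≢g′ _ _ (sym eq)) x∈
         ; m< (inj₂ (here eq))         → g≢u m< eq
         ; m< (inj₂ (there (here eq))) → g≢v m< eq })

  slack : ∀ {x y} d → x + d ≡ y → x ≤ y
  slack d refl = m≤m+n _ d

  range : ∀ {k m} j → j ≤ k → m < suc ((k ∸ j) / 2) → 2 * m + j ≤ k
  range {k} {m} j j≤k (s≤s m≤) = subst (2 * m + j ≤_) (m∸n+n≡m j≤k) (+-monoˡ-≤ j
    (≤-trans (*-monoʳ-≤ 2 m≤) (subst (_≤ k ∸ j) (*-comm ((k ∸ j) / 2) 2) (m/n*n≤m (k ∸ j) 2))))

  gap : ∀ {x y} d → x + suc d ≡ y → x ≢ y
  gap {x} d refl eq = m+1+n≢m x (sym eq)

  module Bounds (k : ℕ) (4≤k : 4 ≤ k) where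
    exact : ∀ j → j ≤ 16 → 4 * k ∸ j + j ≡ 4 * k
    exact j j≤16 = m∸n+n≡m (≤-trans j≤16 (*-monoʳ-≤ 4 4≤k))

    1≤+k : ∀ x → 1 ≤ x + k
    1≤+k x = ≤-trans (s≤s z≤n) (≤-trans 4≤k (m≤n+m k x))

    1≤2*+k : ∀ x → 1 ≤ 2 * (x + k)
    1≤2*+k x = ≤-trans (1≤+k x) (m≤n*m (x + k) 2)

    rangeₘ : ∀ {m} → m < suc ((k ∸ 2) / 2) → 2 * m + 2 ≤ k
    rangeₘ = range 2 (≤-trans (s≤s (s≤s z≤n)) 4≤k)

    rangeₙ : ∀ {n} → n < suc ((k ∸ 4) / 2) → 2 * n + 4 ≤ k
    rangeₙ = range 4 4≤k

    2m+k-injective : ∀ {i j} → 2 * i + k ≡ 2 * j + k → i ≡ j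
    2m+k-injective eq = *-cancelˡ-≡ _ _ 2 (+-cancelʳ-≡ k _ _ eq)

    exact-<4k : ∀ j .{{_ : NonZero j}} → j ≤ 16 → 4 * k ∸ j < 4 * k
    exact-<4k (suc j) j≤16 = slack j (trans (sym (+-suc _ j)) (exact (suc j) j≤16))

    far : ∀ x j → x + suc j ≤ k → 2 * (x + k) + 2 * j ≢ 4 * k
    far x j p = <⇒≢ (<-≤-trans (slack 1 (lem₁ x k j))
      (≤-trans (*-monoʳ-≤ 2 (+-monoˡ-≤ k p)) (≤-reflexive (lem₂ k)))) where
      lem₁ : ∀ x k j → suc (2 * (x + k) + 2 * j) + 1 ≡ 2 * (x + suc j + k)
      lem₁ = solve-∀
      lem₂ : ∀ k → 2 * (k + k) ≡ 4 * k
      lem₂ = solve-∀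

    2n+k<2k-2 : ∀ n → 2 * n + 4 ≤ k → 2 * n + k < 2 * k ∸ 2
    2n+k<2k-2 n p with m≤n⇒∃[o]m+o≡n p
    ... | s , refl = m+n≤o⇒m≤o∸n _ (slack (1 + s) (lem n s)) where
      lem : ∀ n s → (suc (2 * n + (2 * n + 4 + s)) + 2) + (1 + s) ≡ 2 * (2 * n + 4 + s)
      lem = solve-∀

    2k≤4k-4 : 2 * k ≤ 4 * k ∸ 4
    2k≤4k-4 with m≤n⇒∃[o]m+o≡n 4≤k
    ... | s , refl = m+n≤o⇒m≤o∸n _ (slack (4 + 2 * s) (lem s)) where
      lem : ∀ s → (2 * (4 + s) + 4) + (4 + 2 * s) ≡ 4 * (4 + s)
      lem = solve-∀

a-valid : ∀ k → All (Valid (4 * k)) (a-indices k)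
a-valid k = All.map⁺ (All.applyUpTo⁺₁ id (2 * k) λ {i} i<2k →
  (<-trans (n<1+n′ i) (odd< i<2k) ∷ odd< i<2k ∷ []) , (<⇒≢ (n<1+n′ i) ∷ []) ∷ [] ∷ [])
  where
  n<1+n′ : ∀ i → 2 * i < 2 * i + 1
  n<1+n′ i = slack 0 (lem i) where
    lem : ∀ i → suc (2 * i) + 0 ≡ 2 * i + 1
    lem = solve-∀
  odd< : ∀ {i} → i < 2 * k → 2 * i + 1 < 4 * k
  odd< {i} i<2k = subst₂ _≤_ (lem₁ i) (lem₂ k) (*-monoʳ-≤ 2 i<2k) where
    lem₁ : ∀ i → 2 * suc i ≡ suc (2 * i + 1)
    lem₁ = solve-∀
    lem₂ : ∀ k → 2 * (2 * k) ≡ 4 * k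
    lem₂ = solve-∀

module _ (k : ℕ) (4≤k : 4 ≤ k) where
  private open module B = Bounds k 4≤k

  C₁-valid : Valid (4 * k) (C₁-indices k)
  C₁-valid =
    All.++⁺ (pairs-all f g N (λ m< → <-≤-trans (f<k m<) k≤4k) g<4k)
      (All.++⁺ (pairs-all f′ g′ N′ (λ n< → <-trans (f′<B n<) (≤-<-trans B≤v v<4k)) g′<4k)
               (exact-<4k 1 (s≤s z≤n) ∷ v<4k ∷ []))
    , unique-by-blocks k B f g f′ g′ N N′ (4 * k ∸ 1) (4 * k ∸ 4)
        (*-cancelˡ-≡ _ _ 2)
        (λ {i} {j} eq → 2m+k-injective (∸-cancelʳ-≡ (1≤+k (2 * i)) (1≤+k (2 * j)) (*-cancelˡ-≡ _ _ 2 eq)))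
        (λ eq → 2m+k-injective eq)
        (λ eq → 2m+k-injective (*-cancelˡ-≡ _ _ 2 eq))
        f<k k≤B (λ n → m≤n+m k (2 * n)) f′<B B≤g B≤g′
        (≤-trans B≤v (∸-monoʳ-≤ (4 * k) (s≤s z≤n))) B≤v
        g≢g′ (λ {m} _ → even≢u (2 * m + k ∸ 1)) (λ {m} m< → g≢v m (2 * m + k ∸ 1) (4 * k ∸ 4) (rangeₘ m<) (m∸n+n≡m (1≤+k (2 * m))) (exact 4 4≤16))
        (λ {n} _ → even≢u (2 * n + k)) (λ {n} n< → g′≢v n (4 * k ∸ 4) (rangeₙ n<) (exact 4 4≤16)) u≢v
    where
    f g f′ g′ : ℕ → ℕ
    f  m = 2 * m
    g  m = 2 * (2 * m + k ∸ 1)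
    f′ n = 2 * n + k
    g′ n = 2 * (2 * n + k)
    N N′ B : ℕ
    N  = suc ((k ∸ 2) / 2)
    N′ = suc ((k ∸ 4) / 2)
    B  = 2 * k ∸ 2
    4≤16 : 4 ≤ 16
    4≤16 = s≤s (s≤s (s≤s (s≤s z≤n)))
    k≤4k : k ≤ 4 * k
    k≤4k = m≤n*m k 4
    v<4k : 4 * k ∸ 4 < 4 * k
    v<4k = exact-<4k 4 4≤16
    f<k : ∀ {m} → m < N → f m < k
    f<k {m} m< = ≤-trans (slack 1 (lem m)) (rangeₘ m<) where
      lem : ∀ m → suc (2 * m) + 1 ≡ 2 * m + 2
      lem = solve-∀
    f′<B : ∀ {n} → n < N′ → f′ n < B
    f′<B {n} n< = 2n+k<2k-2 n (rangeₙ n<)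
    k≤B : k ≤ B
    k≤B = m+n≤o⇒m≤o∸n k (subst (k + 2 ≤_) (lem k) (+-monoʳ-≤ k (≤-trans (s≤s (s≤s z≤n)) 4≤k))) where
      lem : ∀ k → k + k ≡ 2 * k
      lem = solve-∀
    B≤v : B ≤ 4 * k ∸ 4
    B≤v = ≤-trans (m∸n≤m (2 * k) 2) 2k≤4k-4
    B≤g : ∀ m → B ≤ g m
    B≤g m = subst (_≤ g m) (*-distribˡ-∸ 2 k 1) (*-monoʳ-≤ 2 (∸-monoˡ-≤ 1 (m≤n+m k (2 * m))))
    B≤g′ : ∀ n → B ≤ g′ n
    B≤g′ n = ≤-trans (m∸n≤m (2 * k) 2) (*-monoʳ-≤ 2 (m≤n+m k (2 * n)))
    g<4k : ∀ {m} → m < N → g m < 4 * k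
    g<4k {m} m< = <-≤-trans
      (*-monoʳ-< 2 (≤-reflexive (m+[n∸m]≡n (1≤+k (2 * m)))))
      (subst (g′ m ≤_) (lem k) (*-monoʳ-≤ 2 (+-monoˡ-≤ k (<⇒≤ (f<k m<))))) where
      lem : ∀ k → 2 * (k + k) ≡ 4 * k
      lem = solve-∀
    g′<4k : ∀ {n} → n < N′ → g′ n < 4 * k
    g′<4k {n} n< = <-≤-trans (*-monoʳ-< 2 (<-≤-trans (f′<B n<) (m∸n≤m (2 * k) 2))) (≤-reflexive (lem k)) where
      lem : ∀ k → 2 * (2 * k) ≡ 4 * k
      lem = solve-∀
    g≢g′ : ∀ m n → g m ≢ g′ n
    g≢g′ m n eq = even≢odd m n (+-cancelʳ-≡ k _ _
      (trans (sym (m+[n∸m]≡n (1≤+k (2 * m)))) (cong suc (*-cancelˡ-≡ _ _ 2 eq))))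
    even≢u : ∀ x → 2 * x ≢ 4 * k ∸ 1
    even≢u x eq = even≢odd (2 * k) x (trans (lem k) (trans (sym (exact 1 (s≤s z≤n)))
      (trans (+-comm _ 1) (cong suc (sym eq))))) where
      lem : ∀ k → 2 * (2 * k) ≡ 4 * k
      lem = solve-∀
    g≢v : ∀ m Y V → 2 * m + 2 ≤ k → Y + 1 ≡ 2 * m + k → V + 4 ≡ 4 * k → 2 * Y ≢ V
    g≢v m Y V p eY eV refl = far (2 * m) 1 p
      (trans (cong (λ z → 2 * z + 2) (sym eY)) (trans (lemY Y) eV)) where
      lemY : ∀ Y → 2 * (Y + 1) + 2 ≡ 2 * Y + 4
      lemY = solve-∀
    g′≢v : ∀ n V → 2 * n + 4 ≤ k → V + 4 ≡ 4 * k → 2 * (2 * n + k) ≢ V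
    g′≢v n V p eV refl = far (2 * n) 2 (<⇒≤ (≤-trans (≤-reflexive (sym (+-suc (2 * n) 3))) p)) eV
    u≢v : 4 * k ∸ 1 ≢ 4 * k ∸ 4
    u≢v eq = gap 2 (+-assoc (4 * k ∸ 1) 1 3)
      (trans (trans (exact 1 (s≤s z≤n)) (sym (exact 4 4≤16))) (cong (_+ 4) (sym eq)))

  C₂-valid : ∀ t → k ≡ 2 * t → Valid (4 * k) (C₂-indices k)
  C₂-valid t k≡2t =
    All.++⁺ (pairs-all f g N (λ m< → <-≤-trans (f<k m<) k≤4k) g<4k)
      (All.++⁺ (pairs-all f′ g′ N′ (λ n< → <-trans (f′<B n<) (≤-<-trans B≤v v<4k)) g′<4k)
               (u<4k ∷ v<4k ∷ []))
    , unique-by-blocks k B f g f′ g′ N N′ (4 * k ∸ 2) (4 * k ∸ 5)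
        (λ eq → *-cancelˡ-≡ _ _ 2 (+-cancelʳ-≡ 1 _ _ eq))
        (λ eq → 2m+k-injective (*-cancelˡ-≡ _ _ 2 (+-cancelʳ-≡ 1 _ _ eq)))
        (λ eq → 2m+k-injective (+-cancelʳ-≡ 1 _ _ eq))
        (λ {i} {j} eq → 2m+k-injective (*-cancelˡ-≡ _ _ 2 (∸-cancelʳ-≡ (1≤2*+k (2 * i)) (1≤2*+k (2 * j)) eq)))
        f<k k≤B (λ n → ≤-trans (m≤n+m k (2 * n)) (m≤m+n _ 1)) f′<B B≤g B≤g′
        (≤-trans B≤v (∸-monoʳ-≤ (4 * k) (s≤s (s≤s z≤n)))) B≤v
        (λ m n → g≢g′ m n (g′ n) (m∸n+n≡m (1≤2*+k (2 * n))))
        (λ {m} _ → g≢u m (4 * k ∸ 2) (exact 2 2≤16))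
        (λ {m} _ → g≢v m (4 * k ∸ 5) (exact 5 5≤16))
        (λ {n} _ → g′≢u n (g′ n) (4 * k ∸ 2) (m∸n+n≡m (1≤2*+k (2 * n))) (exact 2 2≤16))
        (λ {n} n< → g′≢v n (g′ n) (4 * k ∸ 5) (rangeₙ n<) (m∸n+n≡m (1≤2*+k (2 * n))) (exact 5 5≤16))
        u≢v
    where
    f g f′ g′ : ℕ → ℕ
    f  m = 2 * m + 1
    g  m = 2 * (2 * m + k) + 1
    f′ n = 2 * n + k + 1
    g′ n = 2 * (2 * n + k) ∸ 1
    N N′ B : ℕ
    N  = suc ((k ∸ 2) / 2)
    N′ = suc ((k ∸ 4) / 2)
    B  = 2 * k ∸ 1
    2≤16 : 2 ≤ 16
    2≤16 = s≤s (s≤s z≤n)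
    5≤16 : 5 ≤ 16
    5≤16 = s≤s (s≤s (s≤s (s≤s (s≤s z≤n))))
    k≤4k : k ≤ 4 * k
    k≤4k = m≤n*m k 4
    u<4k : 4 * k ∸ 2 < 4 * k
    u<4k = exact-<4k 2 2≤16
    v<4k : 4 * k ∸ 5 < 4 * k
    v<4k = exact-<4k 5 5≤16
    f<k : ∀ {m} → m < N → f m < k
    f<k {m} m< = ≤-trans (slack 0 (lem m)) (rangeₘ m<) where
      lem : ∀ m → suc (2 * m + 1) + 0 ≡ 2 * m + 2
      lem = solve-∀
    f′<B : ∀ {n} → n < N′ → f′ n < B
    f′<B {n} n< with m≤n⇒∃[o]m+o≡n (rangeₙ n<)
    ... | s , eq = subst (λ k → 2 * n + k + 1 < 2 * k ∸ 1) eq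
            (m+n≤o⇒m≤o∸n _ (slack (1 + s) (lem n s))) where
      lem : ∀ n s → (suc (2 * n + (2 * n + 4 + s) + 1) + 1) + (1 + s) ≡ 2 * (2 * n + 4 + s)
      lem = solve-∀
    k≤B : k ≤ B
    k≤B = m+n≤o⇒m≤o∸n k (subst (k + 1 ≤_) (lem k) (+-monoʳ-≤ k (≤-trans (s≤s z≤n) 4≤k))) where
      lem : ∀ k → k + k ≡ 2 * k
      lem = solve-∀
    B≤v : B ≤ 4 * k ∸ 5
    B≤v = subst (B ≤_) (∸-+-assoc (4 * k) 4 1) (∸-monoˡ-≤ 1 2k≤4k-4)
    B≤g : ∀ m → B ≤ g m
    B≤g m = ≤-trans (m∸n≤m (2 * k) 1) (≤-trans (*-monoʳ-≤ 2 (m≤n+m k (2 * m))) (m≤m+n _ 1))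
    B≤g′ : ∀ n → B ≤ g′ n
    B≤g′ n = ∸-monoˡ-≤ 1 (*-monoʳ-≤ 2 (m≤n+m k (2 * n)))
    g<4k : ∀ {m} → m < N → g m < 4 * k
    g<4k {m} m< = ≤-trans (slack 2 (lem₁ m k))
      (≤-trans (*-monoʳ-≤ 2 (+-monoˡ-≤ k (f<k m<))) (≤-reflexive (lem₂ k))) where
      lem₁ : ∀ m k → suc (2 * (2 * m + k) + 1) + 2 ≡ 2 * (suc (2 * m + 1) + k)
      lem₁ = solve-∀
      lem₂ : ∀ k → 2 * (k + k) ≡ 4 * k
      lem₂ = solve-∀
    g′<4k : ∀ {n} → n < N′ → g′ n < 4 * k
    g′<4k {n} n< = <-≤-trans (≤-<-trans (m∸n≤m (2 * (2 * n + k)) 1)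
      (*-monoʳ-< 2 (<-≤-trans (2n+k<2k-2 n (rangeₙ n<)) (m∸n≤m (2 * k) 2)))) (≤-reflexive (lem k)) where
      lem : ∀ k → 2 * (2 * k) ≡ 4 * k
      lem = solve-∀
    g≢g′ : ∀ m n Y → Y + 1 ≡ 2 * (2 * n + k) → g m ≢ Y
    g≢g′ m n Y eY refl = even≢odd n m (+-cancelʳ-≡ k _ _ (*-cancelˡ-≡ _ _ 2 (trans (sym eY) (lem m k)))) where
      lem : ∀ m k → 2 * (2 * m + k) + 1 + 1 ≡ 2 * (suc (2 * m) + k)
      lem = solve-∀
    g≢u : ∀ m U → U + 2 ≡ 4 * k → g m ≢ U
    g≢u m U eU refl = even≢odd (2 * k) (2 * m + k + 1) (trans (lem₁ k) (trans (sym eU) (lem₂ m k))) where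
      lem₁ : ∀ k → 2 * (2 * k) ≡ 4 * k
      lem₁ = solve-∀
      lem₂ : ∀ m k → 2 * (2 * m + k) + 1 + 2 ≡ suc (2 * (2 * m + k + 1))
      lem₂ = solve-∀
    g≢v : ∀ m V → V + 5 ≡ 4 * k → g m ≢ V
    g≢v m V eV refl = even≢odd t (m + 1) (trans (sym k≡2t) (*-cancelˡ-≡ _ _ 2
      (+-cancelʳ-≡ (2 * k) _ _ (trans (lem₁ k) (trans (sym eV) (lem₂ m k)))))) where
      lem₁ : ∀ k → 2 * k + 2 * k ≡ 4 * k
      lem₁ = solve-∀
      lem₂ : ∀ m k → 2 * (2 * m + k) + 1 + 5 ≡ 2 * suc (2 * (m + 1)) + 2 * k
      lem₂ = solve-∀
    g′≢u : ∀ n Y U → Y + 1 ≡ 2 * (2 * n + k) → U + 2 ≡ 4 * k → Y ≢ U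
    g′≢u n Y U eY eU refl = even≢odd (2 * k) (2 * n + k)
      (trans (lem₁ k) (trans (sym eU) (trans (lem₂ Y) (cong suc eY)))) where
      lem₁ : ∀ k → 2 * (2 * k) ≡ 4 * k
      lem₁ = solve-∀
      lem₂ : ∀ Y → Y + 2 ≡ suc (Y + 1)
      lem₂ = solve-∀
    g′≢v : ∀ n Y V → 2 * n + 4 ≤ k → Y + 1 ≡ 2 * (2 * n + k) → V + 5 ≡ 4 * k → Y ≢ V
    g′≢v n Y V p eY eV refl = far (2 * n) 2 (<⇒≤ (≤-trans (≤-reflexive (sym (+-suc (2 * n) 3))) p))
      (trans (cong (_+ 4) (sym eY)) (trans (+-assoc Y 1 4) eV))
    u≢v : 4 * k ∸ 2 ≢ 4 * k ∸ 5
    u≢v eq = gap 2 (+-assoc (4 * k ∸ 2) 2 3)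
      (trans (trans (exact 2 2≤16) (sym (exact 5 5≤16))) (cong (_+ 5) (sym eq)))

module _ (ℓ : ℕ) (2≤ℓ : 2 ≤ ℓ) (c : Fin (4 * 2 ^ ℓ) ↔ A) where
  private
    k : ℕ
    k = 2 ^ ℓ
    4≤k : 4 ≤ k
    4≤k = ^-monoʳ-≤ 2 2≤ℓ
    even : ∀ {ℓ} → 2 ≤ ℓ → ∃ λ t → 2 ^ ℓ ≡ 2 * t
    even (s≤s {n = ℓ′} _) = 2 ^ ℓ′ , refl
    open Group (Sym A) using (_≈_; _∙_)

  a b : A ↔ A
  a = indexCycles c (a-indices k) (a-valid k)
  b = indexCycle c (C₁-indices k) (C₁-valid k 4≤k)
    ∙ indexCycle c (C₂-indices k) (C₂-valid k 4≤k (proj₁ (even 2≤ℓ)) (proj₂ (even 2≤ℓ)))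

  G₁ : Pred (A ↔ A) 0ℓ
  G₁ σ = ∃₂ λ j i → j ≤ 2 * k ∸ 1 × i ≤ 1 × σ ≈ power (Sym A) b j ∙ power (Sym A) a i

module Submission where

-- Write the i-th entry of C₁ and of C₂ as P 0 i and P 1 i, with i modulo 2k.  Then b (P s i) = P s (i + 1),
-- and reading off the indices shows that a (P s i) = P (1 - s) ((k + 1) i).  Since k is even,
-- (k + 1)² = 1 modulo 2k, so a and b generate a copy of ℤ/2k ⋊ ℤ/2 that acts simply transitively
-- on the 4k points P s i.

open import Defs
open import Level using (0ℓ)
open import Algebra.Bundles using (Group)
open import Data.Bool using (Bool; true; false; not; _xor_)
open import Data.Bool.Properties using (xor-assoc; xor-same; xor-identityʳ)
open import Data.Empty using (⊥)
open import Data.Fin using (Fin; fromℕ<; toℕ) renaming (zero to fzero; suc to fsuc)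
import Data.Fin.Properties as Fin
open import Data.List using (List; []; _∷_; _++_; _∷ʳ_; length; lookup; concatMap; upTo; applyUpTo)
open import Data.List.Membership.DecPropositional using (_∈?_)
open import Data.List.Membership.Propositional using (_∈_; _∉_)
open import Data.List.Membership.Propositional.Properties using (∈-lookup; ∈-++⁻; ∈-map⁺; ∈-upTo⁺)
open import Data.List.Properties using (length-++)
open import Data.List.Relation.Binary.Disjoint.Propositional using (Disjoint)
open import Data.List.Relation.Unary.All as All using (All; []; _∷_)
import Data.List.Relation.Unary.All.Properties as All
open import Data.List.Relation.Unary.AllPairs using (AllPairs; []; _∷_)
import Data.List.Relation.Unary.AllPairs.Properties as AllPairs
open import Data.List.Relation.Unary.Any using (here; there)
open import Data.List.Relation.Unary.Unique.Propositional using (Unique)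
import Data.List.Relation.Unary.Unique.Propositional.Properties as Unique
open import Data.Nat
open import Data.Nat.DivMod
open import Data.Nat.Properties
open import Data.Nat.Tactic.RingSolver using (solve-∀)
open import Data.Product using (∃; ∃₂; _×_; _,_; proj₁; proj₂)
open import Data.Sum using (_⊎_; inj₁; inj₂)
open import Function using (_↔_; Inverse; _∘_; id)
open import Relation.Binary using (DecidableEquality)
open import Relation.Binary.PropositionalEquality
open import Relation.Nullary using (¬_; yes; no; contradiction)
open import Relation.Nullary.Decidable using (recompute)
open import Relation.Unary using (Pred)

open Inverse using (to; from; strictlyInverseˡ; strictlyInverseʳ)

-- Regular actions of ℤ/n ⋊ ℤ/2

-- Multiplication by k + 1 modulo 2k fixes the even residues and adds k to the odd ones. So the
-- claim about `a` is that an entry at an even position of C₁ has its partner at the same position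
-- of C₂, and an entry at an odd position has it half a cycle away; parity and half of the cycle
-- give four families to check. The arithmetic progressions in the cycles break in one place. At
-- position 2k - 2 they would give the indices 2k - 2 and 2k - 1, which occur earlier, so 4k - 1 and
-- 4k - 2 stand there instead. This is the only pair whose odd index lies on C₁, and it is what
-- disturbs the separation of the two cycles by parity. No relations between words in `a` and `b`
-- are manipulated: every product acts on positions by an affine map, possibly exchanging the
-- cycles. Closure is a computation with affine maps, and the order and the absence of fixed points
-- follow because one image already determines such a map.

module Congruence (n : ℕ) .{{_ : NonZero n}} where
  infix 4 _≋_
  _≋_ : ℕ → ℕ → Set
  i ≋ j = i % n ≡ j % n

  +-cong-≋ : ∀ {i i′ j j′} → i ≋ i′ → j ≋ j′ → i + j ≋ i′ + j′
  +-cong-≋ {i} {i′} {j} {j′} p q =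
    trans (%-distribˡ-+ i j n) (trans (cong₂ (λ x y → (x + y) % n) p q) (sym (%-distribˡ-+ i′ j′ n)))

  *-cong-≋ : ∀ {i i′ j j′} → i ≋ i′ → j ≋ j′ → i * j ≋ i′ * j′
  *-cong-≋ {i} {i′} {j} {j′} p q =
    trans (%-distribˡ-* i j n) (trans (cong₂ (λ x y → (x * y) % n) p q) (sym (%-distribˡ-* i′ j′ n)))

  -- Here j may exceed n, where `n ∸ j` would truncate; with this choice j + neg j is the multiple n
  -- j.
  neg : ℕ → ℕ
  neg j = (n ∸ 1) * j

  +-neg : ∀ j → j + neg j ≋ 0
  +-neg j = trans (cong (_% n) (trans (cong (_* j) (m+[n∸m]≡n (>-nonZero⁻¹ n))) (*-comm n j)))
                  (trans (m*n%n≡0 j n) (sym (m*n%n≡0 0 n)))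

  +-cancelʳ-≋ : ∀ i {j} → j + i ≋ i → j ≋ 0
  +-cancelʳ-≋ i {j} p = begin
    j % n               ≡⟨ cong (_% n) (+-identityʳ j) ⟨
    (j + 0) % n         ≡⟨ +-cong-≋ {j} refl (sym (+-neg i)) ⟩
    (j + (i + neg i)) % n ≡⟨ cong (_% n) (+-assoc j i (neg i)) ⟨
    (j + i + neg i) % n ≡⟨ +-cong-≋ p refl ⟩
    (i + neg i) % n     ≡⟨ +-neg i ⟩
    0 % n               ∎
    where open ≡-Reasoning

-- The maps P s i ↦ P (t xor s) (j + rᵗ i) form a group acting simply transitively on the points.
module RegularAction
  {A : Set} (n r : ℕ) .{{_ : NonZero n}} (r²≡1 : (r * r) % n ≡ 1 % n)
  (P : Bool → ℕ → A)
  (P-cong : ∀ s {i j} → i % n ≡ j % n → P s i ≡ P s j)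
  (P-injective : ∀ {s t i j} → P s i ≡ P t j → s ≡ t × i % n ≡ j % n)
  (P-surjective : ∀ x → ∃₂ λ s i → P s i ≡ x)
  (α β : A ↔ A)
  (α-P : ∀ s i → to α (P s i) ≡ P (not s) (r * i))
  (β-P : ∀ s i → to β (P s i) ≡ P s (suc i))
  where

  open Congruence n
  open Group (Sym A) using (_≈_; _∙_; ε; _⁻¹)

  products : Pred (A ↔ A) 0ℓ
  products σ = ∃₂ λ j i → j ≤ n ∸ 1 × i ≤ 1 × σ ≈ power (Sym A) β j ∙ power (Sym A) α i

  twist : Bool → ℕ → ℕ
  twist false i = i
  twist true  i = r * i

  twist-cong : ∀ s {i j} → i ≋ j → twist s i ≋ twist s j
  twist-cong false eq = eq
  twist-cong true  eq = *-cong-≋ {r} refl eq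

  twist-+ : ∀ s i j → twist s (i + j) ≡ twist s i + twist s j
  twist-+ false i j = refl
  twist-+ true  i j = *-distribˡ-+ r i j

  twist-0 : ∀ s → twist s 0 ≡ 0
  twist-0 false = refl
  twist-0 true  = *-zeroʳ r

  -- The twists compose like ℤ/2 only modulo n; within this module `r²≡1` enters only here.
  twist-twist : ∀ s t i → twist s (twist t i) ≋ twist (s xor t) i
  twist-twist false t     i = refl
  twist-twist true  false i = refl
  twist-twist true  true  i = begin
    (r * (r * i)) % n ≡⟨ cong (_% n) (*-assoc r r i) ⟨
    (r * r * i) % n   ≡⟨ *-cong-≋ r²≡1 refl ⟩
    (1 * i) % n       ≡⟨ cong (_% n) (*-identityˡ i) ⟩
    i % n             ∎
    where open ≡-Reasoning

  -- The coordinate j is an arbitrary natural number, not a residue, so products and inverses get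
  -- plain formulas; it is reduced below n only on returning to `products`.
  record Acts (σ : A ↔ A) (j : ℕ) (t : Bool) : Set where
    constructor acts
    field act : ∀ s i → to σ (P s i) ≡ P (t xor s) (j + twist t i)
  open Acts

  ≈-from-P : ∀ {σ τ} → (∀ s i → to σ (P s i) ≡ to τ (P s i)) → σ ≈ τ
  ≈-from-P eq x with P-surjective x
  ... | s , i , refl = eq s i

  β-power : ∀ j s i → to (power (Sym A) β j) (P s i) ≡ P s (j + i)
  β-power zero    s i = refl
  β-power (suc j) s i = trans (cong (to β) (β-power j s i)) (β-P s (j + i))

  products⇒acts : ∀ {σ} → products σ → ∃₂ (Acts σ)
  products⇒acts (j , zero , _ , _ , eq) = j , false , acts λ s i → trans (eq (P s i)) (β-power j s i)
  products⇒acts (j , suc zero , _ , _ , eq) = j , true , acts λ s i →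
    trans (eq (P s i)) (trans (cong (to (power (Sym A) β j)) (α-P s i)) (β-power j (not s) (r * i)))
  products⇒acts (_ , suc (suc _) , _ , s≤s () , _)

  exponent : Bool → ℕ
  exponent false = 0
  exponent true  = 1

  exponent≤1 : ∀ t → exponent t ≤ 1
  exponent≤1 false = z≤n
  exponent≤1 true  = s≤s z≤n

  element : ℕ → Bool → A ↔ A
  element j t = power (Sym A) β (j % n) ∙ power (Sym A) α (exponent t)

  element∈products : ∀ j t → products (element j t)
  element∈products j t = j % n , exponent t , <⇒≤pred (m%n<n j n) , exponent≤1 t , λ _ → refl

  reduce : ∀ j i → j % n + i ≋ j + i
  reduce j i = +-cong-≋ {j % n} (m%n%n≡m%n j n) refl

  element-acts : ∀ j t → Acts (element j t) j t
  element-acts j false = acts λ s i → trans (β-power (j % n) s i) (P-cong s (reduce j i))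
  element-acts j true  = acts λ s i → trans (cong (to (power (Sym A) β (j % n))) (α-P s i))
    (trans (β-power (j % n) (not s) (r * i)) (P-cong (not s) (reduce j (r * i))))

  -- The product of powers with the same coordinates agrees with σ on every `P s i`, and these
  -- exhaust A. Hence closure of `products` only requires that affine maps be closed.
  acts⇒products : ∀ {σ j t} → Acts σ j t → products σ
  acts⇒products {σ} {j} {t} actσ = j % n , exponent t , <⇒≤pred (m%n<n j n) , exponent≤1 t ,
    ≈-from-P {σ} {element j t} λ s i → trans (act actσ s i) (sym (act (element-acts j t) s i))

  acts-∙ : ∀ {σ τ j j′ t t′} → Acts σ j t → Acts τ j′ t′ → Acts (σ ∙ τ) (j + twist t j′) (t xor t′)
  acts-∙ {σ} {τ} {j} {j′} {t} {t′} actσ actτ = acts λ s i → let u = (t xor t′) xor s in begin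
    to σ (to τ (P s i))                                 ≡⟨ cong (to σ) (act actτ s i) ⟩
    to σ (P (t′ xor s) (j′ + twist t′ i))               ≡⟨ act actσ (t′ xor s) _ ⟩
    P (t xor (t′ xor s)) (j + twist t (j′ + twist t′ i)) ≡⟨ cong (λ u → P u _) (xor-assoc t t′ s) ⟨
    P u (j + twist t (j′ + twist t′ i))                 ≡⟨ cong (λ x → P u (j + x)) (twist-+ t j′ _) ⟩
    P u (j + (twist t j′ + twist t (twist t′ i)))       ≡⟨ cong (P u) (+-assoc j _ _) ⟨
    P u (j + twist t j′ + twist t (twist t′ i))         ≡⟨ P-cong u (+-cong-≋ {j + twist t j′} refl (twist-twist t t′ i)) ⟩
    P u (j + twist t j′ + twist (t xor t′) i)           ∎
    where open ≡-Reasoning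

  -- Solving j + rᵗ x = i gives x = rᵗ (i - j), because rᵗ is its own inverse modulo n. It is enough
  -- to check that σ sends this candidate back to `P s i`.
  acts-⁻¹ : ∀ {σ j t} → Acts σ j t → Acts (σ ⁻¹) (twist t (neg j)) t
  acts-⁻¹ {σ} {j} {t} actσ = acts λ s i → begin
    from σ (P s i)                              ≡⟨ cong (from σ) (image s i) ⟨
    from σ (to σ (P (t xor s) (twist t (neg j) + twist t i))) ≡⟨ strictlyInverseʳ σ _ ⟩
    P (t xor s) (twist t (neg j) + twist t i)   ∎
    where
    open ≡-Reasoning
    exact : ∀ i → j + twist t (twist t (neg j) + twist t i) ≋ i
    exact i = begin
      (j + twist t (twist t (neg j) + twist t i)) % n       ≡⟨ cong (λ x → (j + twist t x) % n) (twist-+ t (neg j) i) ⟨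
      (j + twist t (twist t (neg j + i))) % n               ≡⟨ +-cong-≋ {j} refl (twist-twist t t (neg j + i)) ⟩
      (j + twist (t xor t) (neg j + i)) % n                 ≡⟨ cong (λ u → (j + twist u (neg j + i)) % n) (xor-same t) ⟩
      (j + (neg j + i)) % n                                 ≡⟨ cong (_% n) (+-assoc j (neg j) i) ⟨
      (j + neg j + i) % n                                   ≡⟨ +-cong-≋ (+-neg j) refl ⟩
      i % n                                                 ∎
    image : ∀ s i → to σ (P (t xor s) (twist t (neg j) + twist t i)) ≡ P s i
    image s i = let i′ = j + twist t (twist t (neg j) + twist t i) in begin
      to σ (P (t xor s) (twist t (neg j) + twist t i)) ≡⟨ act actσ _ _ ⟩
      P (t xor (t xor s)) i′                           ≡⟨ cong (λ u → P u i′) (xor-assoc t t s) ⟨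
      P ((t xor t) xor s) i′                           ≡⟨ cong (λ u → P (u xor s) i′) (xor-same t) ⟩
      P s i′                                           ≡⟨ P-cong s (exact i) ⟩
      P s i                                            ∎

  isSubgroup : IsSubgroup (Sym A) products
  isSubgroup = record
    { respects  = λ σ≈τ (j , i , j≤ , i≤ , eq) → j , i , j≤ , i≤ , λ x → trans (sym (σ≈τ x)) (eq x)
    ; ε-closed  = 0 , 0 , z≤n , z≤n , λ _ → refl
    ; ∙-closed  = λ {σ} {τ} σ∈ τ∈ →
        acts⇒products {σ ∙ τ} (acts-∙ {σ} {τ} (proj₂ (proj₂ (products⇒acts {σ} σ∈))) (proj₂ (proj₂ (products⇒acts {τ} τ∈))))
    ; ⁻¹-closed = λ {σ} σ∈ → acts⇒products {σ ⁻¹} (acts-⁻¹ {σ} (proj₂ (proj₂ (products⇒acts {σ} σ∈))))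
    }

  origin : A
  origin = P false 0

  acts-origin : ∀ {σ j t} → Acts σ j t → to σ origin ≡ P t j
  acts-origin {σ} {j} {t} actσ = begin
    to σ origin                      ≡⟨ act actσ false 0 ⟩
    P (t xor false) (j + twist t 0)  ≡⟨ cong₂ P (xor-identityʳ t) (trans (cong (j +_) (twist-0 t)) (+-identityʳ j)) ⟩
    P t j                            ∎
    where open ≡-Reasoning

  -- The image of `origin` is `P t j`, from which injectivity of P recovers t and j modulo n, that
  -- is, the whole map.
  ≈-from-origin : ∀ {σ τ} → products σ → products τ → to σ origin ≡ to τ origin → σ ≈ τ
  ≈-from-origin {σ} {τ} σ∈ τ∈ eq with products⇒acts {σ} σ∈ | products⇒acts {τ} τ∈
  ... | j , t , actσ | j′ , t′ , actτ
    with P-injective {t} {t′} {j} {j′} (trans (sym (acts-origin {σ} actσ)) (trans eq (acts-origin {τ} actτ)))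
  ... | refl , j≋j′ = ≈-from-P {σ} {τ} λ s i →
          trans (act actσ s i) (trans (P-cong (t xor s) (+-cong-≋ j≋j′ refl)) (sym (act actτ s i)))

  transport : A → A ↔ A
  transport x = element (proj₁ (proj₂ (P-surjective x))) (proj₁ (P-surjective x))

  transport∈products : ∀ x → products (transport x)
  transport∈products x = element∈products _ (proj₁ (P-surjective x))

  transport-origin : ∀ x → to (transport x) origin ≡ x
  transport-origin x with P-surjective x
  ... | t , j , refl = acts-origin (element-acts j t)

  -- Evaluation at `origin` is a bijection from the group onto A, so the points are counted instead
  -- of the pairs of exponents.
  hasOrder : ∀ {q} → Fin q ↔ A → HasOrder (Sym A) products q
  hasOrder c = record
    { to        = λ (σ , _) → from c (to σ origin)
    ; from      = λ i → transport (to c i) , transport∈products (to c i)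
    ; to-cong   = λ σ≈τ → cong (from c) (σ≈τ origin)
    ; from-cong = λ { refl _ → refl }
    ; inverse   =
        (λ {i} {(σ , _)} σ≈ → trans (cong (from c) (trans (σ≈ origin) (transport-origin (to c i)))) (strictlyInverseʳ c i))
      , λ { {σ , σ∈} refl → ≈-from-origin {transport (to c (from c (to σ origin)))} {σ} (transport∈products _) σ∈
              (trans (transport-origin _) (strictlyInverseˡ c (to σ origin))) }
    }

  xor-cancelʳ : ∀ s {t} → t xor s ≡ s → t ≡ false
  xor-cancelʳ s     {false} _  = refl
  xor-cancelʳ true  {true}  ()
  xor-cancelʳ false {true}  ()

  -- A fixed point stays on its own cycle, so t is `false` and there is no twist; then j + i ≡ i
  -- forces j ≡ 0.
  fixedPoint⇒ε : ∀ σ → products σ → HasFixedPoint σ → σ ≈ ε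
  fixedPoint⇒ε σ σ∈ (x , fix) with products⇒acts {σ} σ∈ | P-surjective x
  ... | j , t , actσ | s , i , refl with P-injective {t xor s} {s} {j + twist t i} {i} (trans (sym (act actσ s i)) fix)
  ... | t-xor-s≡s , eq with xor-cancelʳ s {t} t-xor-s≡s
  ... | refl = ≈-from-P {σ} {ε} λ s′ i′ →
          trans (act actσ s′ i′) (P-cong s′ (+-cong-≋ (+-cancelʳ-≋ i {j} eq) refl))

-- Cycles given by the positions of their entries

private variable
  A : Set
  xs ys : List A
  x y : A
  i j : ℕ

infix 4 _[_]=_
-- Lookup as a relation: positions can be shifted along `_++_` without carrying bounds on the index.
data _[_]=_ {A : Set} : List A → ℕ → A → Set where
  here  : (x ∷ xs) [ 0 ]= x
  there : xs [ i ]= x → (y ∷ xs) [ suc i ]= x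

[]=⇒∈ : xs [ i ]= x → x ∈ xs
[]=⇒∈ here      = here refl
[]=⇒∈ (there p) = there ([]=⇒∈ p)

∈⇒[]= : x ∈ xs → ∃ λ i → xs [ i ]= x
∈⇒[]= (here refl) = 0 , here
∈⇒[]= (there x∈) with ∈⇒[]= x∈
... | i , p = suc i , there p

[]=⇒<length : xs [ i ]= x → i < length xs
[]=⇒<length here      = s≤s z≤n
[]=⇒<length (there p) = s≤s ([]=⇒<length p)

[]=-injective : Unique xs → xs [ i ]= x → xs [ j ]= x → i ≡ j
[]=-injective (_  ∷ xs!) here      here      = refl
[]=-injective (x∉ ∷ _)   here      (there q) = contradiction refl (All.lookup x∉ ([]=⇒∈ q))
[]=-injective (x∉ ∷ _)   (there p) here      = contradiction refl (All.lookup x∉ ([]=⇒∈ p))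
[]=-injective (_  ∷ xs!) (there p) (there q) = cong suc ([]=-injective xs! p q)

[]=-++⁺ˡ : xs [ i ]= x → (xs ++ ys) [ i ]= x
[]=-++⁺ˡ here      = here
[]=-++⁺ˡ (there p) = there ([]=-++⁺ˡ p)

[]=-++⁺ʳ : ∀ xs → ys [ i ]= x → (xs ++ ys) [ length xs + i ]= x
[]=-++⁺ʳ []       p = p
[]=-++⁺ʳ (_ ∷ xs) p = there ([]=-++⁺ʳ xs p)

-- Junk value 0 past the end of the list.
nth : List ℕ → ℕ → ℕ
nth []       _       = 0
nth (x ∷ _)  zero    = x
nth (_ ∷ xs) (suc i) = nth xs i

[]=⇒nth : ∀ {xs x} → xs [ i ]= x → nth xs i ≡ x
[]=⇒nth here      = refl
[]=⇒nth (there p) = []=⇒nth p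

<length⇒[]= : ∀ {xs} → i < length xs → xs [ i ]= nth xs i
<length⇒[]= {zero}  {_ ∷ _} _         = here
<length⇒[]= {suc i} {_ ∷ _} (s≤s i<n) = there (<length⇒[]= i<n)

data Next {A : Set} (xs : List A) (x y : A) : Set where
  step : xs [ i ]= x → xs [ suc i ]= y → Next xs x y
  wrap : suc i ≡ length xs → xs [ i ]= x → xs [ 0 ]= y → Next xs x y

lookup-injective : Unique xs → ∀ i j → lookup xs i ≡ lookup xs j → i ≡ j
lookup-injective (_  ∷ _)   fzero    fzero    _  = refl
lookup-injective (x∉ ∷ _)   fzero    (fsuc j) eq = contradiction eq (All.lookup x∉ (∈-lookup j))
lookup-injective (x∉ ∷ _)   (fsuc i) fzero    eq = contradiction (sym eq) (All.lookup x∉ (∈-lookup i))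
lookup-injective (_  ∷ xs!) (fsuc i) (fsuc j) eq = cong fsuc (lookup-injective xs! i j eq)

-- Pigeonhole: positions inject into `Fin q`.
Valid⇒length≤ : ∀ {q is} → Valid q is → length is ≤ q
Valid⇒length≤ {q} {is} (<q , is!) = Fin.injective⇒≤ {f = λ i → fromℕ< (All.lookup <q (∈-lookup {xs = is} i))}
  λ {i} {j} eq → lookup-injective is! i j (Fin.fromℕ<-injective _ _ _ _ eq)

-- A missing m could be put in front, making q + 1 distinct entries below q. Counting thus shows
-- that C₁ and C₂ cover every index, without locating each one.
Valid-exhaustive : ∀ {q is m} → Valid q is → length is ≡ q → m < q → m ∈ is
Valid-exhaustive {q} {is} {m} (<q , is!) len m<q with _∈?_ _≟_ m is
... | yes m∈ = m∈
... | no  m∉ = contradiction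
  (subst (λ l → suc l ≤ q) len
    (Valid⇒length≤ (m<q ∷ <q , All.tabulate (λ {j} j∈ m≡j → m∉ (subst (_∈ is) (sym m≡j) j∈)) ∷ is!)))
  1+n≰n

module _ (_≟ᴬ_ : DecidableEquality A) where

  relabel-[]= : ∀ {us vs : List A} {x y} → Unique us → us [ i ]= x → vs [ i ]= y → relabel _≟ᴬ_ us vs x ≡ y
  relabel-[]= {x = x} _ (here {x = u}) here with x ≟ᴬ u
  ... | yes _  = refl
  ... | no x≢x = contradiction refl x≢x
  relabel-[]= {us = u ∷ us} {x = x} (u∉ ∷ us!) (there p) (there q) with x ≟ᴬ u
  ... | yes refl = contradiction refl (All.lookup u∉ ([]=⇒∈ p))
  ... | no _     = relabel-[]= us! p q

  relabel-∉ : ∀ (us vs : List A) {x} → x ∉ us → relabel _≟ᴬ_ us vs x ≡ x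
  relabel-∉ []       _        _   = refl
  relabel-∉ (_ ∷ _)  []       _   = refl
  relabel-∉ (u ∷ us) (v ∷ vs) {x} x∉ with x ≟ᴬ u
  ... | yes refl = contradiction (here refl) x∉
  ... | no  _    = relabel-∉ us vs (x∉ ∘ there)

  Next⇒rotate : ∀ {xs : List A} {x y} → Next xs x y → ∃ λ i → xs [ i ]= x × rotate _≟ᴬ_ xs [ i ]= y
  Next⇒rotate (step p (there q)) = _ , p , []=-++⁺ˡ q
  Next⇒rotate {xs = x₀ ∷ xs} {y = y} (wrap {i = i} eq p here) = _ , p ,
    subst (λ j → (xs ∷ʳ x₀) [ j ]= x₀) (trans (+-identityʳ (length xs)) (sym (suc-injective eq)))
      ([]=-++⁺ʳ xs here)

  cycle-Next : ∀ {xs : List A} {x y} (xs! : Unique xs) → Next xs x y → to (cycle _≟ᴬ_ xs xs!) x ≡ y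
  cycle-Next xs! next with Next⇒rotate next
  ... | _ , p , q = relabel-[]= xs! p q

module Enumeration {q : ℕ} .{{_ : NonZero q}} (c : Fin q ↔ A) where

  -- Reduction modulo q makes the enumeration total, so no bound has to accompany an index; for m <
  -- q it is the m-th element.
  elem : ℕ → A
  elem m = to c (m mod q)

  fromℕ<≡mod : ∀ {m} .(m<q : m < q) → fromℕ< m<q ≡ m mod q
  fromℕ<≡mod {m} m<q = Fin.fromℕ<-cong _ _ (sym (m<n⇒m%n≡m (recompute (m <? q) m<q))) _ _

  to-injective : ∀ {i j} → to c i ≡ to c j → i ≡ j
  to-injective eq = trans (sym (strictlyInverseʳ c _)) (trans (cong (from c) eq) (strictlyInverseʳ c _))

  elem-injective : ∀ {m m′} → m < q → m′ < q → elem m ≡ elem m′ → m ≡ m′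
  elem-injective m<q m′<q eq = Fin.fromℕ<-injective _ _ m<q m′<q
    (trans (fromℕ<≡mod m<q) (trans (to-injective eq) (sym (fromℕ<≡mod m′<q))))

  elem-surjective : ∀ x → ∃ λ m → m < q × elem m ≡ x
  elem-surjective x = toℕ (from c x) , Fin.toℕ<n _ ,
    trans (cong (to c) (trans (sym (fromℕ<≡mod (Fin.toℕ<n (from c x)))) (Fin.fromℕ<-toℕ _ _))) (strictlyInverseˡ c x)

  entries-[]= : ∀ {is m} .(<q : All (_< q) is) → is [ i ]= m → entries c is <q [ i ]= elem m
  entries-[]= <q (here {xs = is}) =
    subst (λ x → x ∷ entries c is (All.tail <q) [ 0 ]= elem _) (cong (to c) (sym (fromℕ<≡mod (All.head <q)))) here
  entries-[]= <q (there p) = there (entries-[]= (All.tail <q) p)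

  length-entries : ∀ is .(<q : All (_< q) is) → length (entries c is <q) ≡ length is
  length-entries []       _  = refl
  length-entries (i ∷ is) <q = cong suc (length-entries is (All.tail <q))

  entries-Next : ∀ {is m m′} .(<q : All (_< q) is) → Next is m m′ → Next (entries c is <q) (elem m) (elem m′)
  entries-Next <q (step p p′)         = step (entries-[]= <q p) (entries-[]= <q p′)
  entries-Next {is} <q (wrap eq p p′) =
    wrap (trans eq (sym (length-entries is <q))) (entries-[]= <q p) (entries-[]= <q p′)

  entries-∉ : ∀ {m} is (<q : All (_< q) is) → m < q → m ∉ is → elem m ∉ entries c is <q
  entries-∉ (i ∷ is) (i<q ∷ <q) m<q m∉ (here eq) =
    m∉ (here (elem-injective m<q i<q (trans eq (cong (to c) (fromℕ<≡mod i<q)))))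
  entries-∉ (i ∷ is) (i<q ∷ <q) m<q m∉ (there x∈) = entries-∉ is <q m<q (m∉ ∘ there) x∈

  indexCycle-Next : ∀ {is m m′} (v : Valid q is) → Next is m m′ → to (indexCycle c is v) (elem m) ≡ elem m′
  indexCycle-Next {is} (<q , is!) next =
    cycle-Next (enumerated-≟ c) (entries-unique c is <q is!) (entries-Next <q next)

  indexCycle-∉ : ∀ {is m} (v : Valid q is) → m < q → m ∉ is → to (indexCycle c is v) (elem m) ≡ elem m
  indexCycle-∉ {is} (<q , _) m<q m∉ = relabel-∉ (enumerated-≟ c) (entries c is <q) _ (entries-∉ is <q m<q m∉)

  indexCycles-∉ : ∀ {iss m} (vs : All (Valid q) iss) → m < q → All (m ∉_) iss →
                  to (indexCycles c iss vs) (elem m) ≡ elem m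
  indexCycles-∉ []       _   _          = refl
  indexCycles-∉ {is ∷ iss} (v ∷ vs) m<q (m∉ ∷ m∉s) =
    trans (cong (to (indexCycle c is v)) (indexCycles-∉ vs m<q m∉s)) (indexCycle-∉ v m<q m∉)

  Next⇒∈ˡ : ∀ {is : List ℕ} {m m′} → Next is m m′ → m ∈ is
  Next⇒∈ˡ (step p _)   = []=⇒∈ p
  Next⇒∈ˡ (wrap _ p _) = []=⇒∈ p

  Next⇒∈ʳ : ∀ {is : List ℕ} {m m′} → Next is m m′ → m′ ∈ is
  Next⇒∈ʳ (step _ p)   = []=⇒∈ p
  Next⇒∈ʳ (wrap _ _ p) = []=⇒∈ p

  -- Factors to the right of `is` act first and fix m; factors to the left act afterwards and fix
  -- m′, which lies on the same cycle as m.
  indexCycles-Next : ∀ {iss is m m′} (vs : All (Valid q) iss) → AllPairs Disjoint iss → is ∈ iss → Next is m m′ →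
                     to (indexCycles c iss vs) (elem m) ≡ elem m′
  indexCycles-Next {iss = is ∷ iss} (v@(<q , _) ∷ vs) (dis ∷ _) (here refl) next = trans
    (cong (to (indexCycle c is v))
      (indexCycles-∉ vs (All.lookup <q (Next⇒∈ˡ next)) (All.map (λ dis m∈ → dis (Next⇒∈ˡ next , m∈)) dis)))
    (indexCycle-Next v next)
  indexCycles-Next {iss = is ∷ iss} (v ∷ vs) (dis ∷ diss) (there is∈) next = trans
    (cong (to (indexCycle c is v)) (indexCycles-Next vs diss is∈ next))
    (indexCycle-∉ v (All.lookup (proj₁ (All.lookup vs is∈)) (Next⇒∈ʳ next))
      (λ m∈ → All.lookup dis is∈ (m∈ , Next⇒∈ʳ next)))

-- Positions on C₁ and C₂

-- Turns each truncated subtraction in the index formulas into a polynomial identity within reach of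
-- the ring solver.
∸-unique : ∀ {y} z d → y ≡ z + d → y ∸ d ≡ z
∸-unique z d refl = m+n∸n≡m z d

module _ (f g : ℕ → ℕ) where

  pairs : ℕ → List ℕ
  pairs n = concatMap (λ m → f m ∷ g m ∷ []) (upTo n)

  private
    -- The function h is there for the induction: the tail of `upTo (suc n)` is `applyUpTo suc n`,
    -- no longer an `upTo`.
    pairs′ : (ℕ → ℕ) → ℕ → List ℕ
    pairs′ h n = concatMap (λ m → f m ∷ g m ∷ []) (applyUpTo h n)

    pairs′-even : ∀ {m n} h → m < n → pairs′ h n [ m * 2 ]= f (h m)
    pairs′-even {zero}  h (s≤s _)   = here
    pairs′-even {suc m} h (s≤s m<n) = there (there (pairs′-even (h ∘ suc) m<n))

    pairs′-odd : ∀ {m n} h → m < n → pairs′ h n [ suc (m * 2) ]= g (h m)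
    pairs′-odd {zero}  h (s≤s _)   = there here
    pairs′-odd {suc m} h (s≤s m<n) = there (there (pairs′-odd (h ∘ suc) m<n))

    length-pairs′ : ∀ h n → length (pairs′ h n) ≡ n * 2
    length-pairs′ h zero    = refl
    length-pairs′ h (suc n) = cong (suc ∘ suc) (length-pairs′ (h ∘ suc) n)

  pairs-even : ∀ {m n} → m < n → pairs n [ m * 2 ]= f m
  pairs-even = pairs′-even id

  pairs-odd : ∀ {m n} → m < n → pairs n [ suc (m * 2) ]= g m
  pairs-odd = pairs′-odd id

  length-pairs : ∀ n → length (pairs n) ≡ n * 2
  length-pairs = length-pairs′ id

  pairs-all : ∀ {P : ℕ → Set} n → (∀ {m} → m < n → P (f m)) → (∀ {m} → m < n → P (g m)) → All P (pairs n)
  pairs-all n pf pg = All.concat⁺ (All.map⁺ (All.applyUpTo⁺₁ id n λ m<n → pf m<n ∷ pg m<n ∷ []))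

-- The common shape of `C₁-indices` and `C₂-indices`. The block lengths are parameters so that the
-- quotients in the definitions can be exchanged for t and t - 1.
module Blocks (f g f′ g′ : ℕ → ℕ) (x y : ℕ) (n n′ : ℕ) where

  blocks : List ℕ
  blocks = pairs f g n ++ pairs f′ g′ n′ ++ x ∷ y ∷ []

  private
    shift : ∀ {ys : List ℕ} {i z} → ys [ i ]= z → (pairs f g n ++ ys) [ n * 2 + i ]= z
    shift {ys} {i} {z} p =
      subst (λ l → (pairs f g n ++ ys) [ l + i ]= z) (length-pairs f g n) ([]=-++⁺ʳ (pairs f g n) p)

    shift′ : ∀ {ys : List ℕ} i {z} → ys [ i ]= z → (pairs f′ g′ n′ ++ ys) [ i + n′ * 2 ]= z
    shift′ {ys} i {z} p =
      subst (λ l → (pairs f′ g′ n′ ++ ys) [ l ]= z) (trans (cong (_+ i) (length-pairs f′ g′ n′)) (+-comm (n′ * 2) i))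
        ([]=-++⁺ʳ (pairs f′ g′ n′) p)

  at-f : ∀ {m} → m < n → blocks [ m * 2 ]= f m
  at-f m<n = []=-++⁺ˡ (pairs-even f g m<n)

  at-g : ∀ {m} → m < n → blocks [ suc (m * 2) ]= g m
  at-g m<n = []=-++⁺ˡ (pairs-odd f g m<n)

  at-f′ : ∀ {m} → m < n′ → blocks [ n * 2 + m * 2 ]= f′ m
  at-f′ m<n = shift ([]=-++⁺ˡ (pairs-even f′ g′ m<n))

  at-g′ : ∀ {m} → m < n′ → blocks [ n * 2 + suc (m * 2) ]= g′ m
  at-g′ m<n = shift ([]=-++⁺ˡ (pairs-odd f′ g′ m<n))

  at-x : blocks [ n * 2 + n′ * 2 ]= x
  at-x = shift (shift′ 0 here)

  at-y : blocks [ n * 2 + suc (n′ * 2) ]= y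
  at-y = shift (shift′ 1 (there here))

  length-blocks : length blocks ≡ n * 2 + (n′ * 2 + 2)
  length-blocks = trans (length-++ (pairs f g n))
    (cong₂ _+_ (length-pairs f g n) (trans (length-++ (pairs f′ g′ n′)) (cong (_+ 2) (length-pairs f′ g′ n′))))

  blocks-all : ∀ {P : ℕ → Set} →
    (∀ {m} → m < n → P (f m)) → (∀ {m} → m < n → P (g m)) →
    (∀ {m} → m < n′ → P (f′ m)) → (∀ {m} → m < n′ → P (g′ m)) → P x → P y → All P blocks
  blocks-all pf pg pf′ pg′ px py =
    All.++⁺ (pairs-all f g n pf pg) (All.++⁺ (pairs-all f′ g′ n′ pf′ pg′) (px ∷ py ∷ []))

parity-rec : ∀ {Q : ℕ → Set} t → (∀ {m} → m < t → Q (m * 2)) → (∀ {m} → m < t → Q (suc (m * 2))) →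
             ∀ {i} → i < t * 2 → Q i
parity-rec (suc t) even odd {zero}        _               = even (s≤s z≤n)
parity-rec (suc t) even odd {suc zero}    _               = odd (s≤s z≤n)
parity-rec {Q} (suc t) even odd {suc (suc i)} (s≤s (s≤s i<)) =
  parity-rec {Q ∘ suc ∘ suc} t (even ∘ s≤s) (odd ∘ s≤s) i<

splitAt-rec : ∀ {Q : ℕ → Set} l r → (∀ {i} → i < l → Q i) → (∀ {i} → i < r → Q (l + i)) → ∀ {i} → i < l + r → Q i
splitAt-rec zero    r low high i<        = high i<
splitAt-rec (suc l) r low high {zero}  _ = low (s≤s z≤n)
splitAt-rec {Q} (suc l) r low high {suc i} (s≤s i<) = splitAt-rec {Q ∘ suc} l r (low ∘ s≤s) high i<

-- Partners under the transpositions of `a`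

Swapped : ℕ → ℕ → Set
Swapped x y = ∃ λ i → (x ≡ 2 * i × y ≡ 2 * i + 1) ⊎ (x ≡ 2 * i + 1 × y ≡ 2 * i)

Swapped-sym : ∀ {x y} → Swapped x y → Swapped y x
Swapped-sym (i , inj₁ (p , q)) = i , inj₂ (q , p)
Swapped-sym (i , inj₂ (p , q)) = i , inj₁ (q , p)

a-disjoint : ∀ k → AllPairs Disjoint (a-indices k)
a-disjoint k = AllPairs.map⁺ (AllPairs.applyUpTo⁺₁ id (2 * k) λ {i} {j} i<j j< → λ where
    (here refl , here eq)                         → <⇒≢ i<j (*-cancelˡ-≡ i j 2 eq)
    (here refl , there (here eq))                 → odd≢ j i (sym eq)
    (there (here refl) , here eq)                 → odd≢ i j eq
    (there (here refl) , there (here eq))         → <⇒≢ i<j (*-cancelˡ-≡ i j 2 (+-cancelʳ-≡ 1 _ _ eq)))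
  where
  odd≢ : ∀ i j → 2 * i + 1 ≢ 2 * j
  odd≢ i j eq = even≢odd j i (trans (sym eq) (+-comm (2 * i) 1))

a-swaps : ∀ {A : Set} {k x y} .{{_ : NonZero (4 * k)}} (c : Fin (4 * k) ↔ A) (vs : All (Valid (4 * k)) (a-indices k)) →
          x < 4 * k → y < 4 * k → Swapped x y →
          to (indexCycles c (a-indices k) vs) (Enumeration.elem c x) ≡ Enumeration.elem c y
a-swaps {k = k} {x} {y} c vs x< y< (i , swapped) =
  Enumeration.indexCycles-Next c vs (a-disjoint k) (∈-map⁺ _ (∈-upTo⁺ (i<2k swapped))) (next swapped)
  where
  half : ∀ {z} → z ≡ 2 * i → z < 4 * k → i < 2 * k
  half refl z< = *-cancelˡ-< 2 i (2 * k) (<-≤-trans z< (≤-reflexive (lem k))) where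
    lem : ∀ k → 4 * k ≡ 2 * (2 * k)
    lem = solve-∀
  i<2k : (x ≡ 2 * i × y ≡ 2 * i + 1) ⊎ (x ≡ 2 * i + 1 × y ≡ 2 * i) → i < 2 * k
  i<2k (inj₁ (p , _)) = half p x<
  i<2k (inj₂ (_ , p)) = half p y<
  next : (x ≡ 2 * i × y ≡ 2 * i + 1) ⊎ (x ≡ 2 * i + 1 × y ≡ 2 * i) → Next (2 * i ∷ 2 * i + 1 ∷ []) x y
  next (inj₁ (refl , refl)) = step here (there here)
  next (inj₂ (refl , refl)) = wrap refl (there here) here

%-remove-multiple : ∀ n .{{_ : NonZero n}} {i} j l → i ≡ j + l * n → i % n ≡ j % n
%-remove-multiple n j l eq = trans (cong (_% n) eq) ([m+kn]%n≡m%n j l n)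

-- Evidence at position i of the first cycle that its partner stands at r i on the second. `pos` is
-- a genuine list position, whereas r i usually runs past the end of the list. The converse
-- direction follows from the symmetry of `Swapped` and r² ≡ 1.
record Mate (n r : ℕ) .{{_ : NonZero n}} (cyc : Bool → List ℕ) (i : ℕ) : Set where
  constructor mate
  field
    {pos left right} : ℕ
    left-at  : cyc false [ i ]= left
    right-at : cyc true [ pos ]= right
    swapped  : Swapped left right
    position : (r * i) % n ≡ pos % n

cycles : ℕ → Bool → List ℕ
cycles k false = C₁-indices k
cycles k true  = C₂-indices k

-- k = 2 t with t = 2 + u, so that the block lengths (k ∸ 2) / 2 + 1 and (k ∸ 4) / 2 + 1 are t and t ∸ 1.
module _ (u : ℕ) where

  private
    t k n : ℕ
    t = 2 + u
    k = 2 * t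
    n = 2 * k
    cyc : Bool → List ℕ
    cyc = cycles k

  f₁ g₁ f₁′ g₁′ f₂ g₂ f₂′ g₂′ : ℕ → ℕ
  f₁  m = 2 * m
  g₁  m = 2 * (2 * m + k ∸ 1)
  f₁′ m = 2 * m + k
  g₁′ m = 2 * (2 * m + k)
  f₂  m = 2 * m + 1
  g₂  m = 2 * (2 * m + k) + 1
  f₂′ m = 2 * m + k + 1
  g₂′ m = 2 * (2 * m + k) ∸ 1

  module B₁ = Blocks f₁ g₁ f₁′ g₁′ (4 * k ∸ 1) (4 * k ∸ 4)
  module B₂ = Blocks f₂ g₂ f₂′ g₂′ (4 * k ∸ 2) (4 * k ∸ 5)
  module L₁ = B₁ t (suc u)
  module L₂ = B₂ t (suc u)

  N≡t : suc ((k ∸ 2) / 2) ≡ t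
  N≡t = cong suc (trans (cong (_/ 2) (∸-unique ((1 + u) * 2) 2 (lem u))) (m*n/n≡m (1 + u) 2)) where
    lem : ∀ u → 2 * (2 + u) ≡ (1 + u) * 2 + 2
    lem = solve-∀

  N′≡1+u : suc ((k ∸ 4) / 2) ≡ suc u
  N′≡1+u = cong suc (trans (cong (_/ 2) (∸-unique (u * 2) 4 (lem u))) (m*n/n≡m u 2)) where
    lem : ∀ u → 2 * (2 + u) ≡ u * 2 + 4
    lem = solve-∀

  cyc₁≡ : cyc false ≡ L₁.blocks
  cyc₁≡ = cong₂ B₁.blocks N≡t N′≡1+u

  cyc₂≡ : cyc true ≡ L₂.blocks
  cyc₂≡ = cong₂ B₂.blocks N≡t N′≡1+u

  length-cyc : ∀ s → length (cyc s) ≡ n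
  length-cyc = λ where
      false → trans (cong length cyc₁≡) (trans L₁.length-blocks (lem u))
      true  → trans (cong length cyc₂≡) (trans L₂.length-blocks (lem u))
    where
    lem : ∀ u → (2 + u) * 2 + (suc u * 2 + 2) ≡ 2 * (2 * (2 + u))
    lem = solve-∀

  -- The indices on C₁ are even and those on C₂ odd, except for 4k ∸ 1 on C₁ and 4k ∸ 2 on C₂.
  Class₁ Class₂ : ℕ → Set
  Class₁ x = (∃ λ y → x ≡ 2 * y × x + 2 ≢ 4 * k) ⊎ x + 1 ≡ 4 * k
  Class₂ x = (∃ λ y → x ≡ 2 * y + 1 × x + 1 ≢ 4 * k) ⊎ x + 2 ≡ 4 * k

  -- Every regular entry x of block index m has x < 4 (m + 1) + 4 t ≤ 8 t = 4 k; d is the slack.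
  bounded : ∀ {m x} d → m < t → x + suc d ≡ 4 * suc m + 4 * t → x ≢ 4 * k
  bounded {m} {x} d m<t eq refl = m+1+n≰m x (≤-trans (≤-reflexive eq)
    (≤-trans (+-monoˡ-≤ (4 * t) (*-monoʳ-≤ 4 m<t)) (≤-reflexive (lem u)))) where
    lem : ∀ u → 4 * (2 + u) + 4 * (2 + u) ≡ 4 * (2 * (2 + u))
    lem = solve-∀

  class₁-even : ∀ m {x} y d → m < t → x ≡ 2 * y → 2 * y + 2 + suc d ≡ 4 * suc m + 4 * t → Class₁ x
  class₁-even m y d m<t refl eq = inj₁ (y , refl , bounded {m} d m<t eq)

  class₂-odd : ∀ m {x} y d → m < t → x ≡ 2 * y + 1 → 2 * y + 1 + 1 + suc d ≡ 4 * suc m + 4 * t → Class₂ x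
  class₂-odd m y d m<t refl eq = inj₁ (y , refl , bounded {m} d m<t eq)

  g₁≡ : ∀ m → g₁ m ≡ 2 * (2 * m + 2 * u + 3)
  g₁≡ m = cong (2 *_) (∸-unique _ 1 (lem u m)) where
    lem : ∀ u m → 2 * m + 2 * (2 + u) ≡ 2 * m + 2 * u + 3 + 1
    lem = solve-∀

  g₂′≡ : ∀ m → g₂′ m ≡ 2 * (2 * m + 2 * u + 3) + 1
  g₂′≡ m = ∸-unique _ 1 (lem u m) where
    lem : ∀ u m → 2 * (2 * m + 2 * (2 + u)) ≡ 2 * (2 * m + 2 * u + 3) + 1 + 1
    lem = solve-∀

  f₁′≡ : ∀ m → f₁′ m ≡ 2 * (m + t)
  f₁′≡ m = lem u m where
    lem : ∀ u m → 2 * m + 2 * (2 + u) ≡ 2 * (m + (2 + u))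
    lem = solve-∀

  f₂′≡ : ∀ m → f₂′ m ≡ 2 * (m + t) + 1
  f₂′≡ m = cong (_+ 1) (f₁′≡ m)

  4k∸1≡ : 4 * k ∸ 1 ≡ 2 * (4 * u + 7) + 1
  4k∸1≡ = ∸-unique _ 1 (lem u) where
    lem : ∀ u → 4 * (2 * (2 + u)) ≡ 2 * (4 * u + 7) + 1 + 1
    lem = solve-∀

  4k∸2≡ : 4 * k ∸ 2 ≡ 2 * (4 * u + 7)
  4k∸2≡ = ∸-unique _ 2 (lem u) where
    lem : ∀ u → 4 * (2 * (2 + u)) ≡ 2 * (4 * u + 7) + 2
    lem = solve-∀

  -- The final entry continues the progression `g₁′` one step past its block. The entry before it
  -- cannot continue `f₁′`, whose next value 2k - 2 equals `g₁ 0`.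
  4k∸4≡ : 4 * k ∸ 4 ≡ g₁′ (suc u)
  4k∸4≡ = ∸-unique _ 4 (lem u) where
    lem : ∀ u → 4 * (2 * (2 + u)) ≡ 2 * (2 * suc u + 2 * (2 + u)) + 4
    lem = solve-∀

  4k∸5≡ : 4 * k ∸ 5 ≡ 2 * (2 * suc u + 2 * u + 3) + 1
  4k∸5≡ = ∸-unique _ 5 (lem u) where
    lem : ∀ u → 4 * (2 * (2 + u)) ≡ 2 * (2 * suc u + 2 * u + 3) + 1 + 5
    lem = solve-∀

  class₁ : All Class₁ (cyc false)
  class₁ = subst (All Class₁) (sym cyc₁≡) (L₁.blocks-all
    -- Each slack is what remains of 4 (m + 1) + 4 t after subtracting the entry, the offset 2 of
    -- the excluded value, and 1 for strictness.
    (λ {m} m< → class₁-even m m (2 * m + 4 * u + 9) m< refl (lem₁ u m))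
    (λ {m} m< → class₁-even m (2 * m + 2 * u + 3) 3 m< (g₁≡ m) (lem₂ u m))
    (λ {m} m< → class₁-even m (m + t) (2 * m + 2 * u + 5) (m<n⇒m<1+n m<) (f₁′≡ m) (lem₃ u m))
    (λ {m} m< → class₁-even m (2 * m + k) 1 (m<n⇒m<1+n m<) refl (lem₄ u m))
    (inj₂ (trans (cong (_+ 1) 4k∸1≡) (lem₅ u)))
    (class₁-even (suc u) (2 * suc u + k) 1 ≤-refl 4k∸4≡ (lem₄ u (suc u)))) where
    lem₁ : ∀ u m → 2 * m + 2 + suc (2 * m + 4 * u + 9) ≡ 4 * suc m + 4 * (2 + u)
    lem₁ = solve-∀
    lem₂ : ∀ u m → 2 * (2 * m + 2 * u + 3) + 2 + suc 3 ≡ 4 * suc m + 4 * (2 + u)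
    lem₂ = solve-∀
    lem₃ : ∀ u m → 2 * (m + (2 + u)) + 2 + suc (2 * m + 2 * u + 5) ≡ 4 * suc m + 4 * (2 + u)
    lem₃ = solve-∀
    lem₄ : ∀ u m → 2 * (2 * m + 2 * (2 + u)) + 2 + suc 1 ≡ 4 * suc m + 4 * (2 + u)
    lem₄ = solve-∀
    lem₅ : ∀ u → 2 * (4 * u + 7) + 1 + 1 ≡ 4 * (2 * (2 + u))
    lem₅ = solve-∀

  class₂ : All Class₂ (cyc true)
  class₂ = subst (All Class₂) (sym cyc₂≡) (L₂.blocks-all
    (λ {m} m< → class₂-odd m m (2 * m + 4 * u + 9) m< refl (lem₁ u m))
    (λ {m} m< → class₂-odd m (2 * m + k) 1 m< refl (lem₂ u m))
    (λ {m} m< → class₂-odd m (m + t) (2 * m + 2 * u + 5) (m<n⇒m<1+n m<) (f₂′≡ m) (lem₃ u m))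
    (λ {m} m< → class₂-odd m (2 * m + 2 * u + 3) 3 (m<n⇒m<1+n m<) (g₂′≡ m) (lem₄ u m))
    (inj₂ (trans (cong (_+ 2) 4k∸2≡) (lem₅ u)))
    (class₂-odd (suc u) (2 * suc u + 2 * u + 3) 3 ≤-refl 4k∸5≡ (lem₄ u (suc u)))) where
    lem₁ : ∀ u m → 2 * m + 1 + 1 + suc (2 * m + 4 * u + 9) ≡ 4 * suc m + 4 * (2 + u)
    lem₁ = solve-∀
    lem₂ : ∀ u m → 2 * (2 * m + 2 * (2 + u)) + 1 + 1 + suc 1 ≡ 4 * suc m + 4 * (2 + u)
    lem₂ = solve-∀
    lem₃ : ∀ u m → 2 * (m + (2 + u)) + 1 + 1 + suc (2 * m + 2 * u + 5) ≡ 4 * suc m + 4 * (2 + u)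
    lem₃ = solve-∀
    lem₄ : ∀ u m → 2 * (2 * m + 2 * u + 3) + 1 + 1 + suc 3 ≡ 4 * suc m + 4 * (2 + u)
    lem₄ = solve-∀
    lem₅ : ∀ u → 2 * (4 * u + 7) + 2 ≡ 4 * (2 * (2 + u))
    lem₅ = solve-∀

  classes-disjoint : ∀ {x} → Class₁ x → Class₂ x → ⊥
  classes-disjoint (inj₁ (y , eq , _)) (inj₁ (z , eq′ , _)) =
    even≢odd y z (trans (sym eq) (trans eq′ (+-comm (2 * z) 1)))
  classes-disjoint (inj₁ (_ , _ , x+2≢)) (inj₂ x+2≡)          = x+2≢ x+2≡
  classes-disjoint (inj₂ x+1≡)          (inj₁ (_ , _ , x+1≢)) = x+1≢ x+1≡
  classes-disjoint {x} (inj₂ x+1≡)      (inj₂ x+2≡)           =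
    contradiction (+-cancelˡ-≡ x 2 1 (trans x+2≡ (sym x+1≡))) λ ()

  cyc-disjoint : Disjoint (cyc false) (cyc true)
  cyc-disjoint (x∈₁ , x∈₂) = classes-disjoint (All.lookup class₁ x∈₁) (All.lookup class₂ x∈₂)

  private
    at₁ : ∀ {i x} → L₁.blocks [ i ]= x → cyc false [ i ]= x
    at₁ {i} {x} = subst (_[ i ]= x) (sym cyc₁≡)

    at₂ : ∀ {i x} → L₂.blocks [ i ]= x → cyc true [ i ]= x
    at₂ {i} {x} = subst (_[ i ]= x) (sym cyc₂≡)

    -- The second block stops at m = t - 2 and the last pair is listed apart; this joins it to the
    -- block as the case m = t - 1.
    last-cases : ∀ {Q : ℕ → Set} → (∀ {m} → m < suc u → Q m) → Q (suc u) → ∀ {m} → m < t → Q m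
    last-cases {Q} low last {m} (s≤s m≤) with m≤n⇒m<n∨m≡n m≤
    ... | inj₁ m<   = low m<
    ... | inj₂ refl = last

    even-low : ∀ {m} → m < t → Mate n (suc k) cyc (m * 2)
    even-low {m} m< = mate (at₁ (L₁.at-f m<)) (at₂ (L₂.at-f m<))
      (m , inj₁ (refl , refl)) (%-remove-multiple n {suc k * (m * 2)} (m * 2) m (lem u m)) where
      lem : ∀ u m → suc (2 * (2 + u)) * (m * 2) ≡ m * 2 + m * (2 * (2 * (2 + u)))
      lem = solve-∀

    -- Since k (2m + 1) = m (2k) + k, the partner lies k = 2t positions further on, in the second
    -- half.
    odd-low : ∀ {m} → m < t → Mate n (suc k) cyc (suc (m * 2))
    odd-low {m} m< = mate (at₁ (L₁.at-g m<)) (at₂ (y-at m<))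
      (2 * m + 2 * u + 3 , inj₁ (g₁≡ m , refl)) (%-remove-multiple n {suc k * (suc (m * 2))} (t * 2 + suc (m * 2)) m (lem u m)) where
      -- For m = t - 1 the partner is the final entry 4k - 5, which obeys the same formula as the
      -- block.
      y-at : ∀ {m} → m < t → L₂.blocks [ t * 2 + suc (m * 2) ]= 2 * (2 * m + 2 * u + 3) + 1
      y-at = last-cases {λ m → L₂.blocks [ t * 2 + suc (m * 2) ]= 2 * (2 * m + 2 * u + 3) + 1}
        (λ {m} m< → subst (L₂.blocks [ t * 2 + suc (m * 2) ]=_) (g₂′≡ m) (L₂.at-g′ m<))
        (subst (L₂.blocks [ t * 2 + suc (suc u * 2) ]=_) 4k∸5≡ L₂.at-y)
      lem : ∀ u m → suc (2 * (2 + u)) * suc (m * 2) ≡ (2 + u) * 2 + suc (m * 2) + m * (2 * (2 * (2 + u)))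
      lem = solve-∀

    even-high : ∀ {m} → m < t → Mate n (suc k) cyc (t * 2 + m * 2)
    even-high = last-cases {λ m → Mate n (suc k) cyc (t * 2 + m * 2)}
      (λ {m} m< → mate (at₁ (L₁.at-f′ m<)) (at₂ (L₂.at-f′ m<))
        (m + t , inj₁ (f₁′≡ m , f₂′≡ m)) (%-remove-multiple n {suc k * (t * 2 + m * 2)} (t * 2 + m * 2) (t + m) (lem u m)))
      -- The exceptional pair: 4k - 1, the odd member, is on C₁, hence the reversed orientation.
      (mate (at₁ L₁.at-x) (at₂ L₂.at-x)
        (4 * u + 7 , inj₂ (4k∸1≡ , 4k∸2≡)) (%-remove-multiple n {suc k * (t * 2 + suc u * 2)} (t * 2 + suc u * 2) (t + suc u) (lem u (suc u)))) where
      lem : ∀ u m → suc (2 * (2 + u)) * ((2 + u) * 2 + m * 2) ≡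
                    (2 + u) * 2 + m * 2 + (2 + u + m) * (2 * (2 * (2 + u)))
      lem = solve-∀

    -- Again k is added to an odd position; from the second half this wraps around to 2m + 1 in the
    -- first.
    odd-high : ∀ {m} → m < t → Mate n (suc k) cyc (t * 2 + suc (m * 2))
    odd-high {m} m< = mate (at₁ (x-at m<)) (at₂ (L₂.at-g m<))
      (2 * m + k , inj₁ (refl , refl)) (%-remove-multiple n {suc k * (t * 2 + suc (m * 2))} (suc (m * 2)) (t + suc m) (lem u m)) where
      x-at : ∀ {m} → m < t → L₁.blocks [ t * 2 + suc (m * 2) ]= g₁′ m
      x-at = last-cases {λ m → L₁.blocks [ t * 2 + suc (m * 2) ]= g₁′ m}
        L₁.at-g′
        (subst (L₁.blocks [ t * 2 + suc (suc u * 2) ]=_) 4k∸4≡ L₁.at-y)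
      lem : ∀ u m → suc (2 * (2 + u)) * ((2 + u) * 2 + suc (m * 2)) ≡
                    suc (m * 2) + (2 + u + suc m) * (2 * (2 * (2 + u)))
      lem = solve-∀

  mates : ∀ {i} → i < n → Mate n (suc k) cyc i
  mates {i} i<n = splitAt-rec {Mate n (suc k) cyc} (t * 2) (t * 2) (parity-rec {Mate n (suc k) cyc} t even-low odd-low)
    (parity-rec {λ i → Mate n (suc k) cyc (t * 2 + i)} t even-high odd-high) (subst (i <_) (lem u) i<n) where
    lem : ∀ u → 2 * (2 * (2 + u)) ≡ (2 + u) * 2 + (2 + u) * 2
    lem = solve-∀

-- Coordinates on the enumerated points

suc-%-step : ∀ n .{{_ : NonZero n}} i → suc (i % n) < n → suc i % n ≡ suc (i % n)
suc-%-step n i <n = trans (Congruence.+-cong-≋ n {1} refl (sym (m%n%n≡m%n i n))) (m<n⇒m%n≡m <n)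

suc-%-wrap : ∀ n .{{_ : NonZero n}} i → suc (i % n) ≡ n → suc i % n ≡ 0
suc-%-wrap n i ≡n = trans (Congruence.+-cong-≋ n {1} refl (sym (m%n%n≡m%n i n))) (trans (cong (_% n) ≡n) (n%n≡0 n))

module Points
  {A : Set} (n r q : ℕ) .{{_ : NonZero n}} .{{_ : NonZero q}} (r²≡1 : (r * r) % n ≡ 1 % n) (n+n≡q : n + n ≡ q)
  (c : Fin q ↔ A)
  (cyc : Bool → List ℕ) (valid : ∀ s → Valid q (cyc s)) (length-cyc : ∀ s → length (cyc s) ≡ n)
  (cyc-disjoint : Disjoint (cyc false) (cyc true))
  (α β : A ↔ A)
  (α-swaps : ∀ {x y} → x < q → y < q → Swapped x y → to α (Enumeration.elem c x) ≡ Enumeration.elem c y)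
  (β-moves : ∀ s {x y} → Next (cyc s) x y → to β (Enumeration.elem c x) ≡ Enumeration.elem c y)
  (mates : ∀ {i} → i < n → Mate n r cyc i)
  where

  open Enumeration c

  label : Bool → ℕ → ℕ
  label s i = nth (cyc s) (i % n)

  P : Bool → ℕ → A
  P s i = elem (label s i)

  label-at : ∀ s i → cyc s [ i % n ]= label s i
  label-at s i = <length⇒[]= (subst (i % n <_) (sym (length-cyc s)) (m%n<n i n))

  at⇒label : ∀ s {i m} → cyc s [ i ]= m → label s i ≡ m
  at⇒label s {i} p = trans (cong (nth (cyc s)) (m<n⇒m%n≡m (subst (i <_) (length-cyc s) ([]=⇒<length p)))) ([]=⇒nth p)

  at⇒< : ∀ s {i m} → cyc s [ i ]= m → m < q
  at⇒< s p = All.lookup (proj₁ (valid s)) ([]=⇒∈ p)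

  P-cong : ∀ s {i j} → i % n ≡ j % n → P s i ≡ P s j
  P-cong s = cong (elem ∘ nth (cyc s))

  label-injective : ∀ s t {i j} → label s i ≡ label t j → s ≡ t × i % n ≡ j % n
  label-injective false false {i} {j} eq =
    refl , []=-injective (proj₂ (valid false)) (label-at false i) (subst (cyc false [ j % n ]=_) (sym eq) (label-at false j))
  label-injective true true {i} {j} eq =
    refl , []=-injective (proj₂ (valid true)) (label-at true i) (subst (cyc true [ j % n ]=_) (sym eq) (label-at true j))
  label-injective false true {i} {j} eq = contradiction
    ([]=⇒∈ (label-at false i) , subst (_∈ cyc true) (sym eq) ([]=⇒∈ (label-at true j))) cyc-disjoint
  label-injective true false {i} {j} eq = contradiction
    ([]=⇒∈ (label-at false j) , subst (_∈ cyc true) eq ([]=⇒∈ (label-at true i))) cyc-disjoint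

  P-injective : ∀ {s t i j} → P s i ≡ P t j → s ≡ t × i % n ≡ j % n
  P-injective {s} {t} {i} {j} eq =
    label-injective s t {i} {j} (elem-injective (at⇒< s (label-at s i)) (at⇒< t (label-at t j)) eq)

  exhaustive : ∀ {m} → m < q → m ∈ cyc false ++ cyc true
  exhaustive = Valid-exhaustive
    (All.++⁺ (proj₁ (valid false)) (proj₁ (valid true)) , Unique.++⁺ (proj₂ (valid false)) (proj₂ (valid true)) cyc-disjoint)
    (trans (length-++ (cyc false)) (trans (cong₂ _+_ (length-cyc false) (length-cyc true)) n+n≡q))

  P-surjective : ∀ x → ∃₂ λ s i → P s i ≡ x
  P-surjective x = from-label (elem-surjective x) where
    from-cycle : ∀ s {m} → m ∈ cyc s → elem m ≡ x → ∃₂ λ s i → P s i ≡ x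
    from-cycle s m∈ eq with ∈⇒[]= m∈
    ... | i , p = s , i , trans (cong elem (at⇒label s p)) eq
    from-label : (∃₂ λ m (_ : m < q) → elem m ≡ x) → ∃₂ λ s i → P s i ≡ x
    from-label (m , m< , eq) with ∈-++⁻ (cyc false) (exhaustive m<)
    ... | inj₁ m∈ = from-cycle false m∈ eq
    ... | inj₂ m∈ = from-cycle true m∈ eq

  label-Next : ∀ s i → Next (cyc s) (label s i) (label s (suc i))
  label-Next s i with m≤n⇒m<n∨m≡n (m%n<n i n)
  ... | inj₁ <n = step (label-at s i) (subst (cyc s [_]= label s (suc i)) (suc-%-step n i <n) (label-at s (suc i)))
  ... | inj₂ ≡n = wrap (trans ≡n (sym (length-cyc s))) (label-at s i)
                    (subst (cyc s [_]= label s (suc i)) (suc-%-wrap n i ≡n) (label-at s (suc i)))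

  β-P : ∀ s i → to β (P s i) ≡ P s (suc i)
  β-P s i = β-moves s (label-Next s i)

  α-mates : ∀ i → to α (P false i) ≡ P true (r * i) × to α (P true (r * i)) ≡ P false i
  α-mates i = trans (cong (to α ∘ elem) left≡) (trans (α-swaps left< right< swapped) (sym right≡))
            , trans (cong (to α) right≡) (trans (α-swaps right< left< (Swapped-sym swapped)) (cong elem (sym left≡)))
    where
    open Mate (mates (m%n<n i n))
    left< = at⇒< false left-at
    right< = at⇒< true right-at
    left≡ : label false i ≡ left
    left≡ = []=⇒nth left-at
    right≡ : P true (r * i) ≡ elem right
    right≡ = trans (P-cong true {r * i} {pos} (trans (Congruence.*-cong-≋ n {r} refl (sym (m%n%n≡m%n i n))) position))
               (cong elem (at⇒label true right-at))

  α-P : ∀ s i → to α (P s i) ≡ P (not s) (r * i)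
  α-P false i = proj₁ (α-mates i)
  -- As i ≡ r (r i), the point is the partner of `P false (r * i)`, so the backward half of
  -- `α-mates` applies.
  α-P true  i = trans (cong (to α) (P-cong true {i} {r * (r * i)} i≋)) (proj₂ (α-mates (r * i))) where
    i≋ : i % n ≡ (r * (r * i)) % n
    i≋ = sym (trans (cong (_% n) (sym (*-assoc r r i)))
      (trans (Congruence.*-cong-≋ n {r * r} {1} r²≡1 refl) (cong (_% n) (*-identityˡ i))))

  open RegularAction n r r²≡1 P P-cong
    (λ {s} {t} {i} {j} → P-injective {s} {t} {i} {j}) P-surjective α β α-P β-P public

-- Keeping k a variable lets `refl` replace it by 2 (2 + u), which is impossible for the power 2 ^ ℓ
-- itself.
cycles-properties : ∀ u {k} → k ≡ 2 * (2 + u) → .{{_ : NonZero (2 * k)}} →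
  (suc k * suc k) % (2 * k) ≡ 1 % (2 * k)
  × (∀ s → length (cycles k s) ≡ 2 * k)
  × Disjoint (cycles k false) (cycles k true)
  × (∀ {i} → i < 2 * k → Mate (2 * k) (suc k) (cycles k) i)
cycles-properties u refl = %-remove-multiple (2 * (2 * (2 + u))) 1 (3 + u) (square u) , length-cyc u , cyc-disjoint u , mates u
  where
  square : ∀ u → suc (2 * (2 + u)) * suc (2 * (2 + u)) ≡ 1 + (3 + u) * (2 * (2 * (2 + u)))
  -- With k = 2t this is (k + 1)² = 1 + (t + 1) 2k.
  square = solve-∀

2^ℓ≡2*[2+u] : ∀ {ℓ} → 2 ≤ ℓ → ∃ λ u → 2 ^ ℓ ≡ 2 * (2 + u)
2^ℓ≡2*[2+u] {suc ℓ} (s≤s 1≤ℓ) = 2 ^ ℓ ∸ 2 , cong (2 *_) (sym (m+[n∸m]≡n (^-monoʳ-≤ 2 1≤ℓ)))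

theorem3p1 : (ℓ : ℕ) (2≤ℓ : 2 ≤ ℓ) (F : Field) (c : Fin (4 * 2 ^ ℓ) ↔ Field.Carrier F) →
    IsSubgroup (Sym (Field.Carrier F)) (G₁ ℓ 2≤ℓ c)
    × HasOrder (Sym (Field.Carrier F)) (G₁ ℓ 2≤ℓ c) (4 * 2 ^ ℓ)
    × (∀ g → G₁ ℓ 2≤ℓ c g → ¬ Group._≈_ (Sym (Field.Carrier F)) g (Group.ε (Sym (Field.Carrier F))) → ¬ HasFixedPoint g)
theorem3p1 ℓ 2≤ℓ F c = isSubgroup , hasOrder c , λ g g∈ g≉ε fix → g≉ε (fixedPoint⇒ε g g∈ fix)
  where
  k = 2 ^ ℓ
  instance
    k≢0 : NonZero k
    k≢0 = m^n≢0 2 ℓ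
    2k≢0 : NonZero (2 * k)
    2k≢0 = m*n≢0 2 k
    4k≢0 : NonZero (4 * k)
    4k≢0 = m*n≢0 4 k
  shape = 2^ℓ≡2*[2+u] 2≤ℓ
  properties = cycles-properties (proj₁ shape) (proj₂ shape)
  disjoint = proj₁ (proj₂ (proj₂ properties))
  valid : ∀ s → Valid (4 * k) (cycles k s)
  valid false = C₁-valid k (^-monoʳ-≤ 2 2≤ℓ)
  valid true  = C₂-valid k (^-monoʳ-≤ 2 2≤ℓ) (2 + proj₁ shape) (proj₂ shape)
  moves : ∀ s {x y} → Next (cycles k s) x y → to (b ℓ 2≤ℓ c) (Enumeration.elem c x) ≡ Enumeration.elem c y
  -- Here `b` is read as the product of a two-element list of cycles. The validity proof of C₂
  -- differs from the one inside `b`, but the underlying maps do not depend on it, and the trailing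
  -- identity factor vanishes by computation.
  moves false = Enumeration.indexCycles-Next c (valid false ∷ valid true ∷ []) ((disjoint ∷ []) ∷ [] ∷ []) (here refl)
  moves true  = Enumeration.indexCycles-Next c (valid false ∷ valid true ∷ []) ((disjoint ∷ []) ∷ [] ∷ []) (there (here refl))
  double : ∀ k → 2 * k + 2 * k ≡ 4 * k
  double = solve-∀
  open Points (2 * k) (suc k) (4 * k) (proj₁ properties) (double k) c (cycles k) valid
    (proj₁ (proj₂ properties)) disjoint (a ℓ 2≤ℓ c) (b ℓ 2≤ℓ c)
    (a-swaps {k = k} c (a-valid k)) moves (proj₂ (proj₂ (proj₂ properties)))
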